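{- Let $p\ge 5$ be a prime, let $C,D\in\mathbb{F}_p$, and let $N_0(f)$ be the number of solutions $(x,y,z)\in\mathbb{F}_p^3$ to $f(x,y,z)=0$, where $$f(x,y,z)=x^2+y^2+z^2-xyz+C(x+y+z)-D.$$ Put $D_\bullet=4-2C-\frac{C^2}{4}\in\mathbb{F}_p$. Then the following hold. (i) If $D=D_\bullet$, then $N_0(f)=p^2+1+\sigma(C^2-8C)\cdot p$. (ii) If $D\neq D_\bullet$, then $$N_0(f)=p^2+1+\sigma(D-D_\bullet)\big(1+N_0(\kappa)\big)\cdot p,$$ where $N_0(\kappa)$ is the number of distinct roots in $\mathbb{F}_p$ of the cubic $$\kappa(x)=x^3+(C-2)x^2-(2C+D)x+C^2+2D.$$
   Context: $\sigma:\mathbb{F}_p\to\{ -1,0,1\}\subset\mathbb{Z}$ denotes the quadratic character: $\sigma(a)=1$ if $a$ is a nonzero square, $\sigma(a)=-1$ if $a$ is a non-square, $\sigma(0)=0$. -}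

module Defs where

open import Data.Nat as ℕ using (ℕ; zero; suc; NonZero)
open import Data.Nat.DivMod using (_mod_)
open import Data.Integer using (ℤ; 0ℤ; 1ℤ; -1ℤ)
open import Data.Fin using (Fin; toℕ)
open import Data.Fin.Properties using (_≟_; any?)
open import Data.List using (length; filter; allFin; cartesianProduct)
open import Data.Product using (_,_)
open import Relation.Nullary using (yes; no)

-- The ring ℤ/p on the residues 0, …, p-1; a field for prime p.

𝔽 : ℕ → Set
𝔽 p = Fin p

module _ {p : ℕ} .{{_ : NonZero p}} where

  infixl 6 _+ₚ_ _-ₚ_
  infixl 7 _*ₚ_ _/ₚ_
  infix  8 -ₚ_
  infixr 8 _^ₚ_

  ⟦_⟧ : ℕ → 𝔽 p
  ⟦ n ⟧ = n mod p

  _+ₚ_ : 𝔽 p → 𝔽 p → 𝔽 p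
  a +ₚ b = ⟦ toℕ a ℕ.+ toℕ b ⟧

  _*ₚ_ : 𝔽 p → 𝔽 p → 𝔽 p
  a *ₚ b = ⟦ toℕ a ℕ.* toℕ b ⟧

  -ₚ_ : 𝔽 p → 𝔽 p
  -ₚ a = ⟦ p ℕ.∸ toℕ a ⟧

  _-ₚ_ : 𝔽 p → 𝔽 p → 𝔽 p
  a -ₚ b = a +ₚ -ₚ b

  _^ₚ_ : 𝔽 p → ℕ → 𝔽 p
  a ^ₚ zero  = ⟦ 1 ⟧
  a ^ₚ suc n = a *ₚ a ^ₚ n

  -- Found by search; the junk value 0 is used for non-invertible arguments.
  inv : 𝔽 p → 𝔽 p
  inv a with any? (λ b → a *ₚ b ≟ ⟦ 1 ⟧)
  ... | yes (b , _) = b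
  ... | no  _       = ⟦ 0 ⟧

  _/ₚ_ : 𝔽 p → 𝔽 p → 𝔽 p
  a /ₚ b = a *ₚ inv b

  -- The quadratic character.
  σ : 𝔽 p → ℤ
  σ a with a ≟ ⟦ 0 ⟧ | any? (λ b → b ^ₚ 2 ≟ a)
  ... | yes _ | _     = 0ℤ
  ... | no  _ | yes _ = 1ℤ
  ... | no  _ | no  _ = -1ℤ

  -- Numbers of zeros in 𝔽 p and in (𝔽 p)³; allFin p lists each residue once.
  N₀¹ : (𝔽 p → 𝔽 p) → ℕ
  N₀¹ g = length (filter (λ x → g x ≟ ⟦ 0 ⟧) (allFin p))

  N₀³ : (𝔽 p → 𝔽 p → 𝔽 p → 𝔽 p) → ℕ
  N₀³ g = length (filter (λ (x , y , z) → g x y z ≟ ⟦ 0 ⟧)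
                         (cartesianProduct (allFin p) (cartesianProduct (allFin p) (allFin p))))

  f : (C D : 𝔽 p) → 𝔽 p → 𝔽 p → 𝔽 p → 𝔽 p
  f C D x y z = x ^ₚ 2 +ₚ y ^ₚ 2 +ₚ z ^ₚ 2 -ₚ x *ₚ y *ₚ z +ₚ C *ₚ (x +ₚ y +ₚ z) -ₚ D

  κ : (C D : 𝔽 p) → 𝔽 p → 𝔽 p
  κ C D x = x ^ₚ 3 +ₚ (C -ₚ ⟦ 2 ⟧) *ₚ x ^ₚ 2 -ₚ (⟦ 2 ⟧ *ₚ C +ₚ D) *ₚ x +ₚ C ^ₚ 2 +ₚ ⟦ 2 ⟧ *ₚ D

  D• : (C : 𝔽 p) → 𝔽 p
  D• C = ⟦ 4 ⟧ -ₚ ⟦ 2 ⟧ *ₚ C -ₚ C ^ₚ 2 /ₚ ⟦ 4 ⟧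

{-# OPTIONS --safe #-}
module Submission where

open import Defs
open import Algebra.Bundles using (CommutativeRing)
import Algebra.Properties.AbelianGroup as AbelianGroupProperties
import Algebra.Properties.Ring as RingProperties
import Algebra.Solver.Ring as RingSolver
open import Algebra.Solver.Ring.AlmostCommutativeRing using (fromCommutativeRing; _-Raw-AlmostCommutative⟶_)
open import Algebra.Structures using (IsCommutativeRing)
open import Data.Bool using (true; false; if_then_else_)
open import Data.Fin using (Fin; zero; suc; toℕ)
open import Data.Fin.Permutation using (permutation)
open import Data.Fin.Properties using (_≟_; any?; suc-injective; toℕ-fromℕ<; toℕ-injective; toℕ<n)
open import Data.Integer as ℤ using (ℤ; +_; -[1+_]; 0ℤ; 1ℤ; -1ℤ; _+_; _*_; _-_; -_; _≤_)
import Data.Integer.Properties as ℤ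
open import Data.Integer.Tactic.RingSolver using (solve-∀)
open import Data.List as List using (List; []; _∷_; map; length; filter; tabulate; allFin; cartesianProduct)
open import Data.List.Properties using (filter-++; length-++)
open import Data.Maybe as Maybe using ()
open import Data.Nat as ℕ using (ℕ; zero; suc; NonZero)
open import Data.Nat.Coprimality using (prime⇒coprime; coprime-Bézout)
open import Data.Nat.Divisibility using (_∣_; n∣m*n; m%n≡0⇒n∣m; n∣m⇒m%n≡0)
open import Data.Nat.DivMod using (_%_; %-distribˡ-+; %-distribˡ-*; m<n⇒m%n≡m; n%n≡0; m%n<n)
open import Data.Nat.GCD using (module Bézout)
open import Data.Nat.Primality using (Prime; euclidsLemma)
import Data.Nat.Properties as ℕ
open import Data.Product using (_×_; _,_; ∃)
open import Data.Sum as Sum using (_⊎_; inj₁; inj₂; [_,_]′)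
open import Function using (_∘_; id)
open import Function.Bundles using (_⇔_; mk⇔)
open import Level using (Level)
open import Relation.Binary.PropositionalEquality
open import Relation.Nullary using (Dec; yes; no; does; ¬_; contradiction)
open import Relation.Nullary.Decidable using (dec-true; dec-false; dec⇒maybe; does-⇔; toSum)
open import Relation.Unary using (Pred; Decidable)
open import Algebra.Properties.Semiring.Sum ℤ.+-*-semiring
  using (sum; sum-syntax; sum-cong-≗; sum-permute; ∑-comm; ∑-distrib-+; *-distribˡ-sum; sum-replicate-zero)

private module ℤ-Group = AbelianGroupProperties ℤ.+-0-abelianGroup

-- Solving f = 0 for z gives N₀(f) = p² + Σ_x Σ_y σ(disc(x, y)), where disc is
-- the z-discriminant, a polynomial (x² - 4) y² + … of degree at most 2 in y
-- whose own y-discriminant is 16 (x + 2) κ(x).  A quadratic character sum over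
-- a y² + b y + c with a ≠ 0 is (p - 1) σ(a) or -σ(a) according to whether the
-- discriminant vanishes, so the fibres over x ≠ ±2 contribute -σ(x² - 4), plus
-- p σ(x² - 4) at each root of κ.  With E = D - D•, the identity
-- (x² - 4) (2x + C - 4)² = 4 (x - 2)² E + 4 (x - 2) κ(x) evaluates σ(x² - 4)
-- at these roots, the fibre over -2 supplies the extra p σ(E), and
-- Σ_x σ(x² - 4) = -1 supplies the constant 1.

-- The value `D•` is the one at which `κ` acquires the root -2, since κ(-2) = 4E. The theorem splits
-- there because, when E = 0, the identity that evaluates σ(x² - 4) becomes uninformative: at a root
-- of `κ` other than ±2 the factor 2x + C - 4 vanishes, so both sides are 0. When E ≠ 0 this factor
-- cannot vanish at such a root, and comparing the two sides up to nonzero squares gives σ(x² - 4) =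
-- σ(E). For E = 0 the fibres over ±2 vanish, being multiples of σ(E), and the only x that
-- contributes a multiple of p is x = (4 - C)/2. There 4 (x² - 4) = C² - 8C, which is the origin of
-- the argument of `σ` in part (i). The fibre over 2 depends on whether C = 0, yet needs no separate
-- term in the final formula: κ(2) = C², so the root indicator of `κ` already records the
-- distinction. Facts about `σ` are obtained by counting: its sum over the field is 0,
-- multiplicativity follows from that, and the quadratic character sum reduces to the number of
-- points on a hyperbola.

private
  variable
    ℓ : Level
    n : ℕ
    A B : Set
    P Q : Set ℓ

-- Indicators and finite sums of integers.

𝟙 : Dec P → ℤ
𝟙 P? = if does P? then 1ℤ else 0ℤ

𝟙-yes : (P? : Dec P) → P → 𝟙 P? ≡ 1ℤ
𝟙-yes P? x = cong (if_then 1ℤ else 0ℤ) (dec-true P? x)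

𝟙-no : (P? : Dec P) → ¬ P → 𝟙 P? ≡ 0ℤ
𝟙-no P? ¬x = cong (if_then 1ℤ else 0ℤ) (dec-false P? ¬x)

𝟙-⇔ : P ⇔ Q → (P? : Dec P) (Q? : Dec Q) → 𝟙 P? ≡ 𝟙 Q?
𝟙-⇔ P⇔Q P? Q? = cong (if_then 1ℤ else 0ℤ) (does-⇔ P⇔Q P? Q?)

sum-zero : (t : Fin n → ℤ) → (∀ i → t i ≡ 0ℤ) → sum t ≡ 0ℤ
sum-zero {n} t t≡0 = trans (sum-cong-≗ t≡0) (sum-replicate-zero n)

sum-const : ∀ n c → ∑[ i < n ] c ≡ + n * c
sum-const zero    c = sym (ℤ.*-zeroˡ c)
sum-const (suc n) c = trans (cong (_+_ c) (sum-const n c)) (sym (ℤ.suc-* (+ n) c))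

sum-𝟙≟ : (i : Fin n) → ∑[ j < n ] 𝟙 (j ≟ i) ≡ 1ℤ
sum-𝟙≟ {suc n} zero    = cong (_+_ 1ℤ) (sum-zero {n} (λ j → 𝟙 (suc j ≟ zero)) (λ _ → refl))
sum-𝟙≟ {suc n} (suc i) = trans (ℤ.+-identityˡ _)
  (trans (sum-cong-≗ λ j → 𝟙-⇔ (mk⇔ suc-injective (cong suc)) (suc j ≟ suc i) (j ≟ i)) (sum-𝟙≟ i))

sum-nonpos : (t : Fin n → ℤ) → (∀ i → t i ≤ 0ℤ) → sum t ≤ 0ℤ
sum-nonpos {zero}  t t≤0 = ℤ.≤-refl
sum-nonpos {suc n} t t≤0 = ℤ.+-mono-≤ (t≤0 zero) (sum-nonpos (t ∘ suc) (t≤0 ∘ suc))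

-- Turns one global identity into a pointwise one; this is how the behaviour of `σ` under
-- multiplication by a nonsquare is extracted from a vanishing sum.
sum-nonpos≡0 : (t : Fin n → ℤ) → (∀ i → t i ≤ 0ℤ) → sum t ≡ 0ℤ → ∀ i → t i ≡ 0ℤ
sum-nonpos≡0 {suc n} t t≤0 ∑t≡0 = λ where
    zero    → head≡0
    (suc i) → sum-nonpos≡0 (t ∘ suc) (t≤0 ∘ suc) tail≡0 i
  where
  open ℤ.≤-Reasoning
  head≡0 : t zero ≡ 0ℤ
  head≡0 = ℤ.≤-antisym (t≤0 zero) (begin
    0ℤ                        ≡⟨ ∑t≡0 ⟨
    t zero + sum (t ∘ suc)    ≤⟨ ℤ.+-monoʳ-≤ (t zero) (sum-nonpos (t ∘ suc) (t≤0 ∘ suc)) ⟩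
    t zero + 0ℤ               ≡⟨ ℤ.+-identityʳ (t zero) ⟩
    t zero                    ∎)
  tail≡0 : sum (t ∘ suc) ≡ 0ℤ
  tail≡0 = trans (sym (ℤ.+-identityˡ _)) (trans (cong (_+ sum (t ∘ suc)) (sym head≡0)) ∑t≡0)

-- Counting by filtered lists as sums of indicators.

length-filter-map : {R : Pred B ℓ} (R? : Decidable R) (g : A → B) (xs : List A) →
  length (filter R? (map g xs)) ≡ length (filter (R? ∘ g) xs)
length-filter-map R? g [] = refl
length-filter-map R? g (x ∷ xs) with does (R? (g x))
... | true  = cong suc (length-filter-map R? g xs)
... | false = length-filter-map R? g xs

-- An arbitrary `t` is needed for the induction, since the tail of `tabulate t` is
-- `tabulate (t ∘ suc)`; the case of `allFin` is `t = id`.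
length-filter-tabulate : {R : Pred A ℓ} (R? : Decidable R) (t : Fin n → A) →
  + length (filter R? (tabulate t)) ≡ ∑[ i < n ] 𝟙 (R? (t i))
length-filter-tabulate {n = zero}  R? t = refl
length-filter-tabulate {n = suc n} R? t with does (R? (t zero))
... | true  = cong (_+_ 1ℤ) (length-filter-tabulate R? (t ∘ suc))
... | false = trans (length-filter-tabulate R? (t ∘ suc)) (sym (ℤ.+-identityˡ _))

length-filter-cartesianProduct : {R : Pred (A × B) ℓ} (R? : Decidable R) (t : Fin n → A) (ys : List B) →
  + length (filter R? (cartesianProduct (tabulate t) ys))
    ≡ ∑[ i < n ] (+ length (filter (λ y → R? (t i , y)) ys))
length-filter-cartesianProduct {n = zero}  R? t ys = refl
length-filter-cartesianProduct {n = suc n} R? t ys = begin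
  + length (filter R? (row List.++ rest))                  ≡⟨ cong (λ l → + length l) (filter-++ R? row rest) ⟩
  + length (filter R? row List.++ filter R? rest)          ≡⟨ cong (λ k → + k) (length-++ (filter R? row)) ⟩
  + length (filter R? row) + + length (filter R? rest)     ≡⟨ cong₂ _+_
                                                                (cong (λ k → + k) (length-filter-map R? (t zero ,_) ys))
                                                                (length-filter-cartesianProduct R? (t ∘ suc) ys) ⟩
  _                                                        ∎
  where
  open ≡-Reasoning
  row  = map (t zero ,_) ys
  rest = cartesianProduct (tabulate (t ∘ suc)) ys

-- The ring solver with coefficients in ℤ, so that the residues ⟦ n ⟧ are constants rather than atoms.
module IntegerCoefficients
  {c} {A : Set c} {add mul : A → A → A} {neg : A → A} {0# 1# : A}
  (isCommutativeRing : IsCommutativeRing _≡_ add mul neg 0# 1#)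
  (fromℕ : ℕ → A)
  (fromℕ-0 : fromℕ 0 ≡ 0#)
  (fromℕ-1 : fromℕ 1 ≡ 1#)
  (fromℕ-+ : ∀ m n → fromℕ (m ℕ.+ n) ≡ add (fromℕ m) (fromℕ n))
  (fromℕ-* : ∀ m n → fromℕ (m ℕ.* n) ≡ mul (fromℕ m) (fromℕ n))
  where

  private
    R : CommutativeRing _ _
    R = record { isCommutativeRing = isCommutativeRing }

  open CommutativeRing R
    using (ring; +-commutativeSemigroup; +-identityˡ; +-identityʳ; +-comm; -‿inverseʳ)
    renaming (_+_ to _⊕_; _*_ to _⊗_; -_ to ⊖_; _-_ to _⊝_)
  open import Algebra.Properties.Ring ring
    using (-0#≈0#; -‿involutive; -‿+-comm; -‿distribˡ-*; -‿distribʳ-*)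
  open import Algebra.Properties.CommutativeSemigroup +-commutativeSemigroup using (interchange)
  open ≡-Reasoning

  fromℤ : ℤ → A
  fromℤ (+ n)    = fromℕ n
  fromℤ -[1+ n ] = ⊖ fromℕ (suc n)

  -- Sums of integers of opposite sign are given by `ℤ.⊖`, which is unchanged when a `suc` is
  -- cancelled on both sides. The ring side follows by inserting 1 - 1 and regrouping.
  fromℤ-⊖ : ∀ m n → fromℤ (m ℤ.⊖ n) ≡ fromℕ m ⊝ fromℕ n
  fromℤ-⊖ m zero = begin
    fromℕ m            ≡⟨ +-identityʳ _ ⟨
    fromℕ m ⊕ 0#       ≡⟨ cong (fromℕ m ⊕_) -0#≈0# ⟨
    fromℕ m ⊝ 0#       ≡⟨ cong (fromℕ m ⊝_) fromℕ-0 ⟨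
    fromℕ m ⊝ fromℕ 0  ∎
  fromℤ-⊖ zero (suc n) = begin
    ⊖ fromℕ (suc n)          ≡⟨ +-identityˡ _ ⟨
    0# ⊝ fromℕ (suc n)       ≡⟨ cong (_⊝ fromℕ (suc n)) fromℕ-0 ⟨
    fromℕ 0 ⊝ fromℕ (suc n)  ∎
  fromℤ-⊖ (suc m) (suc n) = begin
    fromℤ (suc m ℤ.⊖ suc n)                       ≡⟨ cong fromℤ (ℤ.[1+m]⊖[1+n]≡m⊖n m n) ⟩
    fromℤ (m ℤ.⊖ n)                               ≡⟨ fromℤ-⊖ m n ⟩
    fromℕ m ⊝ fromℕ n                             ≡⟨ +-identityˡ _ ⟨
    0# ⊕ (fromℕ m ⊝ fromℕ n)                      ≡⟨ cong (_⊕ (fromℕ m ⊝ fromℕ n)) (-‿inverseʳ (fromℕ 1)) ⟨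
    (fromℕ 1 ⊝ fromℕ 1) ⊕ (fromℕ m ⊝ fromℕ n)     ≡⟨ interchange _ _ _ _ ⟩
    (fromℕ 1 ⊕ fromℕ m) ⊕ (⊖ fromℕ 1 ⊝ fromℕ n)   ≡⟨ cong ((fromℕ 1 ⊕ fromℕ m) ⊕_) (-‿+-comm _ _) ⟩
    (fromℕ 1 ⊕ fromℕ m) ⊝ (fromℕ 1 ⊕ fromℕ n)     ≡⟨ cong₂ _⊝_ (fromℕ-+ 1 m) (fromℕ-+ 1 n) ⟨
    fromℕ (suc m) ⊝ fromℕ (suc n)                 ∎

  fromℤ-neg : ∀ i → fromℤ (ℤ.- i) ≡ ⊖ fromℤ i
  fromℤ-neg (+ zero) = begin
    fromℕ 0    ≡⟨ fromℕ-0 ⟩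
    0#         ≡⟨ -0#≈0# ⟨
    ⊖ 0#       ≡⟨ cong ⊖_ fromℕ-0 ⟨
    ⊖ fromℕ 0  ∎
  fromℤ-neg (+ suc n) = refl
  fromℤ-neg -[1+ n ]  = sym (-‿involutive _)

  fromℤ-+ : ∀ i j → fromℤ (i + j) ≡ fromℤ i ⊕ fromℤ j
  fromℤ-+ (+ m) (+ n)       = fromℕ-+ m n
  fromℤ-+ (+ m) -[1+ n ]    = fromℤ-⊖ m (suc n)
  fromℤ-+ -[1+ m ] (+ n)    = trans (fromℤ-⊖ n (suc m)) (+-comm _ _)
  fromℤ-+ -[1+ m ] -[1+ n ] = begin
    ⊖ fromℕ (suc (suc (m ℕ.+ n)))      ≡⟨ cong (λ k → ⊖ fromℕ (suc k)) (ℕ.+-suc m n) ⟨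
    ⊖ fromℕ (suc m ℕ.+ suc n)          ≡⟨ cong ⊖_ (fromℕ-+ (suc m) (suc n)) ⟩
    ⊖ (fromℕ (suc m) ⊕ fromℕ (suc n))  ≡⟨ -‿+-comm _ _ ⟨
    ⊖ fromℕ (suc m) ⊝ fromℕ (suc n)    ∎

  fromℤ-*⁺ : ∀ m j → fromℤ (+ m * j) ≡ fromℕ m ⊗ fromℤ j
  fromℤ-*⁺ m (+ n) = trans (cong fromℤ (sym (ℤ.pos-* m n))) (fromℕ-* m n)
  fromℤ-*⁺ m -[1+ n ] = begin
    fromℤ (+ m * -[1+ n ])          ≡⟨ cong fromℤ (ℤ.neg-distribʳ-* (+ m) (+ suc n)) ⟨
    fromℤ (ℤ.- (+ m * + suc n))     ≡⟨ fromℤ-neg (+ m * + suc n) ⟩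
    ⊖ fromℤ (+ m * + suc n)         ≡⟨ cong ⊖_ (fromℤ-*⁺ m (+ suc n)) ⟩
    ⊖ (fromℕ m ⊗ fromℕ (suc n))     ≡⟨ -‿distribʳ-* _ _ ⟩
    fromℕ m ⊗ (⊖ fromℕ (suc n))     ∎

  fromℤ-* : ∀ i j → fromℤ (i * j) ≡ fromℤ i ⊗ fromℤ j
  fromℤ-* (+ m) j = fromℤ-*⁺ m j
  fromℤ-* -[1+ m ] j = begin
    fromℤ (-[1+ m ] * j)            ≡⟨ cong fromℤ (ℤ.neg-distribˡ-* (+ suc m) j) ⟨
    fromℤ (ℤ.- (+ suc m * j))       ≡⟨ fromℤ-neg (+ suc m * j) ⟩
    ⊖ fromℤ (+ suc m * j)           ≡⟨ cong ⊖_ (fromℤ-*⁺ (suc m) j) ⟩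
    ⊖ (fromℕ (suc m) ⊗ fromℤ j)     ≡⟨ -‿distribˡ-* _ _ ⟩
    (⊖ fromℕ (suc m)) ⊗ fromℤ j     ∎

  fromℤ-morphism : ℤ.+-*-rawRing -Raw-AlmostCommutative⟶ fromCommutativeRing R
  fromℤ-morphism = record
    { ⟦_⟧ = fromℤ
    ; +-homo = fromℤ-+
    ; *-homo = fromℤ-*
    ; -‿homo = fromℤ-neg
    ; 0-homo = fromℕ-0
    ; 1-homo = fromℕ-1
    }

  -- Coefficients are compared in ℤ, so the identities handed to `solve` hold over ℤ. Whatever is
  -- special to the field, such as 4 · 4⁻¹ = 1, is substituted by hand.
  open RingSolver ℤ.+-*-rawRing (fromCommutativeRing R) fromℤ-morphism
    (λ i j → Maybe.map (cong fromℤ) (dec⇒maybe (i ℤ.≟ j))) public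

-- The commutative ring of residues modulo p.

module ModularRing (p : ℕ) .{{_ : NonZero p}} where

  private
    neg : 𝔽 p → 𝔽 p
    neg a = -ₚ a

  toℕ-⟦⟧ : ∀ n → toℕ (⟦_⟧ {p} n) ≡ n % p
  toℕ-⟦⟧ n = toℕ-fromℕ< (m%n<n n p)

  ⟦⟧-cong-% : ∀ {m n} → m % p ≡ n % p → ⟦_⟧ {p} m ≡ ⟦ n ⟧
  ⟦⟧-cong-% {m} {n} eq = toℕ-injective (trans (toℕ-⟦⟧ m) (trans eq (sym (toℕ-⟦⟧ n))))

  ⟦toℕ⟧ : (a : 𝔽 p) → ⟦ toℕ a ⟧ ≡ a
  ⟦toℕ⟧ a = toℕ-injective (trans (toℕ-⟦⟧ (toℕ a)) (m<n⇒m%n≡m (toℕ<n a)))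

  -- Together with `⟦toℕ⟧`, the two homomorphism laws carry the ring laws over from ℕ: write an
  -- element as `⟦ toℕ a ⟧`, apply the law inside the brackets, and return.
  +-homo : ∀ m n → ⟦_⟧ {p} (m ℕ.+ n) ≡ ⟦ m ⟧ +ₚ ⟦ n ⟧
  +-homo m n = ⟦⟧-cong-% (trans (%-distribˡ-+ m n p)
    (cong (_% p) (sym (cong₂ ℕ._+_ (toℕ-⟦⟧ m) (toℕ-⟦⟧ n)))))

  *-homo : ∀ m n → ⟦_⟧ {p} (m ℕ.* n) ≡ ⟦ m ⟧ *ₚ ⟦ n ⟧
  *-homo m n = ⟦⟧-cong-% (trans (%-distribˡ-* m n p)
    (cong (_% p) (sym (cong₂ ℕ._*_ (toℕ-⟦⟧ m) (toℕ-⟦⟧ n)))))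

  ⟦p⟧≡0 : ⟦ p ⟧ ≡ ⟦_⟧ {p} 0
  ⟦p⟧≡0 = ⟦⟧-cong-% (trans (n%n≡0 p) (sym (m<n⇒m%n≡m (ℕ.>-nonZero⁻¹ p))))

  +ₚ-comm : (a b : 𝔽 p) → a +ₚ b ≡ b +ₚ a
  +ₚ-comm a b = cong ⟦_⟧ (ℕ.+-comm (toℕ a) (toℕ b))

  *ₚ-comm : (a b : 𝔽 p) → a *ₚ b ≡ b *ₚ a
  *ₚ-comm a b = cong ⟦_⟧ (ℕ.*-comm (toℕ a) (toℕ b))

  +ₚ-assoc : (a b c : 𝔽 p) → (a +ₚ b) +ₚ c ≡ a +ₚ (b +ₚ c)
  +ₚ-assoc a b c = begin
    (a +ₚ b) +ₚ c                    ≡⟨ cong ((a +ₚ b) +ₚ_) (⟦toℕ⟧ c) ⟨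
    (a +ₚ b) +ₚ ⟦ toℕ c ⟧            ≡⟨ +-homo (toℕ a ℕ.+ toℕ b) (toℕ c) ⟨
    ⟦ toℕ a ℕ.+ toℕ b ℕ.+ toℕ c ⟧    ≡⟨ cong ⟦_⟧ (ℕ.+-assoc (toℕ a) (toℕ b) (toℕ c)) ⟩
    ⟦ toℕ a ℕ.+ (toℕ b ℕ.+ toℕ c) ⟧  ≡⟨ +-homo (toℕ a) (toℕ b ℕ.+ toℕ c) ⟩
    ⟦ toℕ a ⟧ +ₚ (b +ₚ c)            ≡⟨ cong (_+ₚ (b +ₚ c)) (⟦toℕ⟧ a) ⟩
    a +ₚ (b +ₚ c)                    ∎
    where open ≡-Reasoning

  *ₚ-assoc : (a b c : 𝔽 p) → (a *ₚ b) *ₚ c ≡ a *ₚ (b *ₚ c)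
  *ₚ-assoc a b c = begin
    (a *ₚ b) *ₚ c                    ≡⟨ cong ((a *ₚ b) *ₚ_) (⟦toℕ⟧ c) ⟨
    (a *ₚ b) *ₚ ⟦ toℕ c ⟧            ≡⟨ *-homo (toℕ a ℕ.* toℕ b) (toℕ c) ⟨
    ⟦ toℕ a ℕ.* toℕ b ℕ.* toℕ c ⟧    ≡⟨ cong ⟦_⟧ (ℕ.*-assoc (toℕ a) (toℕ b) (toℕ c)) ⟩
    ⟦ toℕ a ℕ.* (toℕ b ℕ.* toℕ c) ⟧  ≡⟨ *-homo (toℕ a) (toℕ b ℕ.* toℕ c) ⟩
    ⟦ toℕ a ⟧ *ₚ (b *ₚ c)            ≡⟨ cong (_*ₚ (b *ₚ c)) (⟦toℕ⟧ a) ⟩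
    a *ₚ (b *ₚ c)                    ∎
    where open ≡-Reasoning

  *ₚ-distribˡ-+ₚ : (a b c : 𝔽 p) → a *ₚ (b +ₚ c) ≡ a *ₚ b +ₚ a *ₚ c
  *ₚ-distribˡ-+ₚ a b c = begin
    a *ₚ (b +ₚ c)                                ≡⟨ cong (_*ₚ (b +ₚ c)) (⟦toℕ⟧ a) ⟨
    ⟦ toℕ a ⟧ *ₚ (b +ₚ c)                        ≡⟨ *-homo (toℕ a) (toℕ b ℕ.+ toℕ c) ⟨
    ⟦ toℕ a ℕ.* (toℕ b ℕ.+ toℕ c) ⟧              ≡⟨ cong ⟦_⟧ (ℕ.*-distribˡ-+ (toℕ a) (toℕ b) (toℕ c)) ⟩
    ⟦ toℕ a ℕ.* toℕ b ℕ.+ toℕ a ℕ.* toℕ c ⟧      ≡⟨ +-homo (toℕ a ℕ.* toℕ b) (toℕ a ℕ.* toℕ c) ⟩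
    a *ₚ b +ₚ a *ₚ c                             ∎
    where open ≡-Reasoning

  +ₚ-identityʳ : (a : 𝔽 p) → a +ₚ ⟦ 0 ⟧ ≡ a
  +ₚ-identityʳ a = begin
    a +ₚ ⟦ 0 ⟧          ≡⟨ cong (_+ₚ ⟦ 0 ⟧) (⟦toℕ⟧ a) ⟨
    ⟦ toℕ a ⟧ +ₚ ⟦ 0 ⟧  ≡⟨ +-homo (toℕ a) 0 ⟨
    ⟦ toℕ a ℕ.+ 0 ⟧     ≡⟨ cong ⟦_⟧ (ℕ.+-identityʳ (toℕ a)) ⟩
    ⟦ toℕ a ⟧           ≡⟨ ⟦toℕ⟧ a ⟩
    a                   ∎
    where open ≡-Reasoning

  *ₚ-identityʳ : (a : 𝔽 p) → a *ₚ ⟦ 1 ⟧ ≡ a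
  *ₚ-identityʳ a = begin
    a *ₚ ⟦ 1 ⟧          ≡⟨ cong (_*ₚ ⟦ 1 ⟧) (⟦toℕ⟧ a) ⟨
    ⟦ toℕ a ⟧ *ₚ ⟦ 1 ⟧  ≡⟨ *-homo (toℕ a) 1 ⟨
    ⟦ toℕ a ℕ.* 1 ⟧     ≡⟨ cong ⟦_⟧ (ℕ.*-identityʳ (toℕ a)) ⟩
    ⟦ toℕ a ⟧           ≡⟨ ⟦toℕ⟧ a ⟩
    a                   ∎
    where open ≡-Reasoning

  +ₚ-inverseʳ : (a : 𝔽 p) → a +ₚ -ₚ a ≡ ⟦ 0 ⟧
  +ₚ-inverseʳ a = begin
    a +ₚ -ₚ a                         ≡⟨ cong (_+ₚ -ₚ a) (⟦toℕ⟧ a) ⟨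
    ⟦ toℕ a ⟧ +ₚ ⟦ p ℕ.∸ toℕ a ⟧      ≡⟨ +-homo (toℕ a) (p ℕ.∸ toℕ a) ⟨
    ⟦ toℕ a ℕ.+ (p ℕ.∸ toℕ a) ⟧       ≡⟨ cong ⟦_⟧ (ℕ.m+[n∸m]≡n (ℕ.<⇒≤ (toℕ<n a))) ⟩
    ⟦ p ⟧                             ≡⟨ ⟦p⟧≡0 ⟩
    ⟦ 0 ⟧                             ∎
    where open ≡-Reasoning

  commutativeRing : CommutativeRing _ _
  commutativeRing = record
    { Carrier = 𝔽 p
    ; _≈_ = _≡_
    ; _+_ = _+ₚ_
    ; _*_ = _*ₚ_
    ; -_ = neg
    ; 0# = ⟦ 0 ⟧
    ; 1# = ⟦ 1 ⟧
    ; isCommutativeRing = record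
      { isRing = record
        { +-isAbelianGroup = record
          { isGroup = record
            { isMonoid = record
              { isSemigroup = record
                { isMagma = record { isEquivalence = isEquivalence ; ∙-cong = cong₂ _+ₚ_ }
                ; assoc = +ₚ-assoc }
              ; identity = comm∧idʳ⇒id +ₚ-comm +ₚ-identityʳ }
            ; inverse = comm∧invʳ⇒inv +ₚ-comm +ₚ-inverseʳ
            ; ⁻¹-cong = cong neg }
          ; comm = +ₚ-comm }
        ; *-cong = cong₂ _*ₚ_
        ; *-assoc = *ₚ-assoc
        ; *-identity = comm∧idʳ⇒id *ₚ-comm *ₚ-identityʳ
        ; distrib = *ₚ-distribˡ-+ₚ , comm∧distrˡ⇒distrʳ *ₚ-comm *ₚ-distribˡ-+ₚ
        }
      ; *-comm = *ₚ-comm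
      }
    }
    where open import Algebra.Consequences.Propositional

  open CommutativeRing commutativeRing public
    using (ring)
    renaming (zeroˡ to *ₚ-zeroˡ; zeroʳ to *ₚ-zeroʳ; *-identityˡ to *ₚ-identityˡ)

  open IntegerCoefficients (CommutativeRing.isCommutativeRing commutativeRing)
    ⟦_⟧ refl refl +-homo *-homo using (solve; con; _:=_; _:+_; _:-_; _:*_; _:^_; :-_; Polynomial) public

-- Zero divisors, inverses and the values of the quadratic character.

module PrimeField {p : ℕ} .{{_ : NonZero p}} (prime : Prime p) where

  open ModularRing p public
  private module R = RingProperties ring

  a-b≡0⇒a≡b : (a b : 𝔽 p) → a -ₚ b ≡ ⟦ 0 ⟧ → a ≡ b
  a-b≡0⇒a≡b a b = R.x∙y⁻¹≈ε⇒x≈y a b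

  toℕ≡0⇒≡0 : (a : 𝔽 p) → toℕ a ≡ 0 → a ≡ ⟦ 0 ⟧
  toℕ≡0⇒≡0 a eq = trans (sym (⟦toℕ⟧ a)) (cong ⟦_⟧ eq)

  ⟦n⟧≡0⇒p∣n : ∀ n → ⟦_⟧ {p} n ≡ ⟦ 0 ⟧ → p ∣ n
  ⟦n⟧≡0⇒p∣n n eq = m%n≡0⇒n∣m n p (begin
    n % p              ≡⟨ toℕ-⟦⟧ n ⟨
    toℕ (⟦_⟧ {p} n)    ≡⟨ cong toℕ eq ⟩
    toℕ (⟦_⟧ {p} 0)    ≡⟨ toℕ-⟦⟧ 0 ⟩
    0 % p              ≡⟨ m<n⇒m%n≡m (ℕ.>-nonZero⁻¹ p) ⟩
    0                  ∎)
    where open ≡-Reasoning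

  p∣n⇒⟦n⟧≡0 : ∀ {n} → p ∣ n → ⟦_⟧ {p} n ≡ ⟦ 0 ⟧
  p∣n⇒⟦n⟧≡0 {n} p∣n = ⟦⟧-cong-% (trans (n∣m⇒m%n≡0 n p p∣n) (sym (m<n⇒m%n≡m (ℕ.>-nonZero⁻¹ p))))

  ab≡0⇒a≡0∨b≡0 : (a b : 𝔽 p) → a *ₚ b ≡ ⟦ 0 ⟧ → a ≡ ⟦ 0 ⟧ ⊎ b ≡ ⟦ 0 ⟧
  ab≡0⇒a≡0∨b≡0 a b eq = Sum.map (factor a) (factor b)
    (euclidsLemma (toℕ a) (toℕ b) prime (⟦n⟧≡0⇒p∣n (toℕ a ℕ.* toℕ b) eq))
    where
    factor : ∀ c → p ∣ toℕ c → c ≡ ⟦ 0 ⟧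
    factor c p∣c = trans (sym (⟦toℕ⟧ c)) (p∣n⇒⟦n⟧≡0 p∣c)

  ab≡0⇒b≡0 : (a b : 𝔽 p) → a ≢ ⟦ 0 ⟧ → a *ₚ b ≡ ⟦ 0 ⟧ → b ≡ ⟦ 0 ⟧
  ab≡0⇒b≡0 a b a≢0 eq = [ (λ a≡0 → contradiction a≡0 a≢0) , id ]′ (ab≡0⇒a≡0∨b≡0 a b eq)

  *ₚ-nonzero : (a b : 𝔽 p) → a ≢ ⟦ 0 ⟧ → b ≢ ⟦ 0 ⟧ → a *ₚ b ≢ ⟦ 0 ⟧
  *ₚ-nonzero a b a≢0 b≢0 eq = b≢0 (ab≡0⇒b≡0 a b a≢0 eq)

  a²≡0⇒a≡0 : (a : 𝔽 p) → a ^ₚ 2 ≡ ⟦ 0 ⟧ → a ≡ ⟦ 0 ⟧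
  -- `a ^ₚ 2` unfolds to `a *ₚ (a *ₚ ⟦ 1 ⟧)`, so the trailing unit is removed first.
  a²≡0⇒a≡0 a eq = [ id , id ]′ (ab≡0⇒a≡0∨b≡0 a a (trans (sym (cong (a *ₚ_) (*ₚ-identityʳ a))) eq))

  -- As 0 < `toℕ a` < p and p is prime, Bézout writes 1 as an integer combination of p and `toℕ a`;
  -- modulo p the coefficient of `toℕ a` is the inverse.
  invertible : (a : 𝔽 p) → a ≢ ⟦ 0 ⟧ → ∃ λ b → a *ₚ b ≡ ⟦ 1 ⟧
  invertible a a≢0 = bézout (coprime-Bézout (prime⇒coprime prime {{toℕ-nonZero}} (toℕ<n a)))
    where
    open ≡-Reasoning
    toℕ-nonZero : NonZero (toℕ a)
    toℕ-nonZero = ℕ.≢-nonZero (a≢0 ∘ toℕ≡0⇒≡0 a)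

    ⟦k*p⟧≡0 : ∀ k → ⟦_⟧ {p} (k ℕ.* p) ≡ ⟦ 0 ⟧
    ⟦k*p⟧≡0 k = p∣n⇒⟦n⟧≡0 (n∣m*n k)

    a*⟦y⟧ : ∀ y → a *ₚ ⟦ y ⟧ ≡ ⟦ y ℕ.* toℕ a ⟧
    a*⟦y⟧ y = begin
      a *ₚ ⟦ y ⟧             ≡⟨ *ₚ-comm a ⟦ y ⟧ ⟩
      ⟦ y ⟧ *ₚ a             ≡⟨ cong (⟦ y ⟧ *ₚ_) (⟦toℕ⟧ a) ⟨
      ⟦ y ⟧ *ₚ ⟦ toℕ a ⟧     ≡⟨ *-homo y (toℕ a) ⟨
      ⟦ y ℕ.* toℕ a ⟧        ∎

    bézout : Bézout.Identity 1 p (toℕ a) → ∃ λ b → a *ₚ b ≡ ⟦ 1 ⟧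
    bézout (Bézout.-+ x y eq) = ⟦ y ⟧ , (begin
      a *ₚ ⟦ y ⟧               ≡⟨ a*⟦y⟧ y ⟩
      ⟦ y ℕ.* toℕ a ⟧          ≡⟨ cong ⟦_⟧ eq ⟨
      ⟦ 1 ℕ.+ x ℕ.* p ⟧        ≡⟨ +-homo 1 (x ℕ.* p) ⟩
      ⟦ 1 ⟧ +ₚ ⟦ x ℕ.* p ⟧     ≡⟨ cong (⟦ 1 ⟧ +ₚ_) (⟦k*p⟧≡0 x) ⟩
      ⟦ 1 ⟧ +ₚ ⟦ 0 ⟧           ≡⟨ +ₚ-identityʳ ⟦ 1 ⟧ ⟩
      ⟦ 1 ⟧                    ∎)
    -- Here 1 + y · `toℕ a` = x · p, so the coefficient of `toℕ a` is -y.
    bézout (Bézout.+- x y eq) = -ₚ ⟦ y ⟧ , (begin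
      a *ₚ -ₚ ⟦ y ⟧                          ≡⟨ solve 2 (λ a y → a :* (:- y) := con 1ℤ :- (con 1ℤ :+ a :* y)) refl a ⟦ y ⟧ ⟩
      ⟦ 1 ⟧ -ₚ (⟦ 1 ⟧ +ₚ a *ₚ ⟦ y ⟧)         ≡⟨ cong (λ t → ⟦ 1 ⟧ -ₚ (⟦ 1 ⟧ +ₚ t)) (a*⟦y⟧ y) ⟩
      ⟦ 1 ⟧ -ₚ (⟦ 1 ⟧ +ₚ ⟦ y ℕ.* toℕ a ⟧)    ≡⟨ cong (_-ₚ_ ⟦ 1 ⟧) (+-homo 1 (y ℕ.* toℕ a)) ⟨
      ⟦ 1 ⟧ -ₚ ⟦ 1 ℕ.+ y ℕ.* toℕ a ⟧         ≡⟨ cong (λ t → ⟦ 1 ⟧ -ₚ ⟦ t ⟧) eq ⟩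
      ⟦ 1 ⟧ -ₚ ⟦ x ℕ.* p ⟧                   ≡⟨ cong (_-ₚ_ ⟦ 1 ⟧) (⟦k*p⟧≡0 x) ⟩
      ⟦ 1 ⟧ -ₚ ⟦ 0 ⟧                         ≡⟨ solve 1 (λ i → i :- con 0ℤ := i) refl ⟦ 1 ⟧ ⟩
      ⟦ 1 ⟧                                  ∎)

  *ₚ-inverseʳ : (a : 𝔽 p) → a ≢ ⟦ 0 ⟧ → a *ₚ inv a ≡ ⟦ 1 ⟧
  *ₚ-inverseʳ a a≢0 with any? (λ b → a *ₚ b ≟ ⟦ 1 ⟧)
  ... | yes (_ , eq) = eq
  ... | no  ∄        = contradiction (invertible a a≢0) ∄

  0²≡0 : ⟦ 0 ⟧ ^ₚ 2 ≡ ⟦_⟧ {p} 0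
  0²≡0 = *ₚ-zeroˡ (⟦ 0 ⟧ *ₚ ⟦ 1 ⟧)

  -- A view of the branches of `σ` that keeps the square root as a witness, so that matching on
  -- `refl` replaces `a` by `b ^ₚ 2`.
  data QuadraticClass (a : 𝔽 p) : Set where
    zero      : a ≡ ⟦ 0 ⟧ → QuadraticClass a
    square    : a ≢ ⟦ 0 ⟧ → (b : 𝔽 p) → b ^ₚ 2 ≡ a → QuadraticClass a
    nonsquare : a ≢ ⟦ 0 ⟧ → (∀ b → b ^ₚ 2 ≢ a) → QuadraticClass a

  classify : (a : 𝔽 p) → QuadraticClass a
  classify a with a ≟ ⟦ 0 ⟧ | any? (λ b → b ^ₚ 2 ≟ a)
  ... | yes a≡0 | _            = zero a≡0
  ... | no  a≢0 | yes (b , eq) = square a≢0 b eq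
  ... | no  a≢0 | no  ∄        = nonsquare a≢0 (λ b eq → ∄ (b , eq))

  σ-zero : ∀ {a : 𝔽 p} → a ≡ ⟦ 0 ⟧ → σ a ≡ 0ℤ
  σ-zero {a} a≡0 with a ≟ ⟦ 0 ⟧ | any? (λ b → b ^ₚ 2 ≟ a)
  ... | yes _   | _ = refl
  ... | no  a≢0 | _ = contradiction a≡0 a≢0

  σ-square : ∀ {a : 𝔽 p} → a ≢ ⟦ 0 ⟧ → (b : 𝔽 p) → b ^ₚ 2 ≡ a → σ a ≡ 1ℤ
  σ-square {a} a≢0 b eq with a ≟ ⟦ 0 ⟧ | any? (λ b → b ^ₚ 2 ≟ a)
  ... | yes a≡0 | _     = contradiction a≡0 a≢0
  ... | no  _   | yes _ = refl
  ... | no  _   | no  ∄ = contradiction (b , eq) ∄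

  σ-nonsquare : ∀ {a : 𝔽 p} → a ≢ ⟦ 0 ⟧ → (∀ b → b ^ₚ 2 ≢ a) → σ a ≡ -1ℤ
  σ-nonsquare {a} a≢0 ∄b with a ≟ ⟦ 0 ⟧ | any? (λ b → b ^ₚ 2 ≟ a)
  ... | yes a≡0 | _            = contradiction a≡0 a≢0
  ... | no  _   | yes (b , eq) = contradiction eq (∄b b)
  ... | no  _   | no  _        = refl

-- Quadratic character sums in odd characteristic.

module OddPrimeField {p : ℕ} .{{_ : NonZero p}} (prime : Prime p) (2≢0 : ⟦_⟧ {p} 2 ≢ ⟦ 0 ⟧) where

  open PrimeField prime public

  4≢0 : ⟦ 4 ⟧ ≢ ⟦_⟧ {p} 0
  4≢0 eq = *ₚ-nonzero ⟦ 2 ⟧ ⟦ 2 ⟧ 2≢0 2≢0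
    (trans (solve 0 (con (+ 2) :* con (+ 2) := con (+ 4)) refl) eq)

  -- The map y ↦ ay + b is a permutation with inverse u ↦ a⁻¹(u - b). This is the change of
  -- variables behind the completed squares and the affine fibres.
  sum-affine : (a b : 𝔽 p) → a ≢ ⟦ 0 ⟧ → (g : 𝔽 p → ℤ) →
    ∑[ y < p ] g (a *ₚ y +ₚ b) ≡ sum g
  sum-affine a b a≢0 g with a⁻¹ , aa⁻¹≡1 ← invertible a a≢0 =
    sym (sum-permute g (permutation (λ y → a *ₚ y +ₚ b) (λ u → a⁻¹ *ₚ (u -ₚ b)) right left))
    where
    right : ∀ u → a *ₚ (a⁻¹ *ₚ (u -ₚ b)) +ₚ b ≡ u
    right u = begin
      a *ₚ (a⁻¹ *ₚ (u -ₚ b)) +ₚ b  ≡⟨ solve 4 (λ a i u b → a :* (i :* (u :- b)) :+ b := a :* i :* (u :- b) :+ b) refl a a⁻¹ u b ⟩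
      a *ₚ a⁻¹ *ₚ (u -ₚ b) +ₚ b    ≡⟨ cong (λ t → t *ₚ (u -ₚ b) +ₚ b) aa⁻¹≡1 ⟩
      ⟦ 1 ⟧ *ₚ (u -ₚ b) +ₚ b       ≡⟨ solve 2 (λ u b → con 1ℤ :* (u :- b) :+ b := u) refl u b ⟩
      u                            ∎
      where open ≡-Reasoning
    left : ∀ y → a⁻¹ *ₚ (a *ₚ y +ₚ b -ₚ b) ≡ y
    left y = begin
      a⁻¹ *ₚ (a *ₚ y +ₚ b -ₚ b)    ≡⟨ solve 4 (λ a i y b → i :* (a :* y :+ b :- b) := a :* i :* y) refl a a⁻¹ y b ⟩
      a *ₚ a⁻¹ *ₚ y                ≡⟨ cong (_*ₚ y) aa⁻¹≡1 ⟩
      ⟦ 1 ⟧ *ₚ y                   ≡⟨ *ₚ-identityˡ y ⟩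
      y                            ∎
      where open ≡-Reasoning

  sum-𝟙-affine : (a b : 𝔽 p) → a ≢ ⟦ 0 ⟧ → ∑[ y < p ] 𝟙 (a *ₚ y +ₚ b ≟ ⟦ 0 ⟧) ≡ 1ℤ
  sum-𝟙-affine a b a≢0 = trans (sum-affine a b a≢0 (λ u → 𝟙 (u ≟ ⟦ 0 ⟧))) (sum-𝟙≟ ⟦ 0 ⟧)

  y²≡b²⇒y≡±b : (y b : 𝔽 p) → y ^ₚ 2 ≡ b ^ₚ 2 → y ≡ b ⊎ y ≡ -ₚ b
  y²≡b²⇒y≡±b y b eq = Sum.map (a-b≡0⇒a≡b y b) (a-b≡0⇒a≡b y (-ₚ b)) (ab≡0⇒a≡0∨b≡0 (y -ₚ b) (y -ₚ -ₚ b) (begin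
    (y -ₚ b) *ₚ (y -ₚ -ₚ b)    ≡⟨ solve 2 (λ y b → (y :- b) :* (y :- (:- b)) := y :^ 2 :- b :^ 2) refl y b ⟩
    y ^ₚ 2 -ₚ b ^ₚ 2           ≡⟨ cong (_-ₚ b ^ₚ 2) eq ⟩
    b ^ₚ 2 -ₚ b ^ₚ 2           ≡⟨ +ₚ-inverseʳ (b ^ₚ 2) ⟩
    ⟦ 0 ⟧                      ∎))
    where open ≡-Reasoning

  -- The squaring map has one preimage over 0, the two preimages ±b over a nonzero b², and none over
  -- a nonsquare.
  count-√ : (a : 𝔽 p) → ∑[ y < p ] 𝟙 (y ^ₚ 2 ≟ a) ≡ 1ℤ + σ a
  count-√ a with classify a
  ... | zero refl = begin
    ∑[ y < p ] 𝟙 (y ^ₚ 2 ≟ ⟦ 0 ⟧)    ≡⟨ sum-cong-≗ (λ y → 𝟙-⇔ (mk⇔ (a²≡0⇒a≡0 y) λ { refl → 0²≡0 }) (y ^ₚ 2 ≟ ⟦ 0 ⟧) (y ≟ ⟦ 0 ⟧)) ⟩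
    ∑[ y < p ] 𝟙 (y ≟ ⟦ 0 ⟧)         ≡⟨ sum-𝟙≟ ⟦ 0 ⟧ ⟩
    1ℤ                               ≡⟨ cong (_+_ 1ℤ) (σ-zero refl) ⟨
    1ℤ + σ (⟦_⟧ {p} 0)               ∎
    where open ≡-Reasoning
  ... | square a≢0 b refl = begin
    ∑[ y < p ] 𝟙 (y ^ₚ 2 ≟ b ^ₚ 2)                               ≡⟨ sum-cong-≗ split ⟩
    ∑[ y < p ] (𝟙 (y ≟ b) + 𝟙 (y ≟ -ₚ b))                        ≡⟨ ∑-distrib-+ (λ y → 𝟙 (y ≟ b)) (λ y → 𝟙 (y ≟ -ₚ b)) ⟩
    ∑[ y < p ] 𝟙 (y ≟ b) + ∑[ y < p ] 𝟙 (y ≟ -ₚ b)               ≡⟨ cong₂ _+_ (sum-𝟙≟ b) (sum-𝟙≟ (-ₚ b)) ⟩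
    1ℤ + 1ℤ                                                      ≡⟨ cong (_+_ 1ℤ) (σ-square a≢0 b refl) ⟨
    1ℤ + σ (b ^ₚ 2)                                              ∎
    where
    open ≡-Reasoning
    -- Odd characteristic enters here: b = -b would give 2b = 0.
    b≢-b : b ≢ -ₚ b
    b≢-b eq = a≢0 (trans (cong (_^ₚ 2) b≡0) 0²≡0)
      where
      b≡0 : b ≡ ⟦ 0 ⟧
      b≡0 = ab≡0⇒b≡0 ⟦ 2 ⟧ b 2≢0 (begin
        ⟦ 2 ⟧ *ₚ b    ≡⟨ solve 1 (λ b → con (+ 2) :* b := b :+ b) refl b ⟩
        b +ₚ b        ≡⟨ cong (b +ₚ_) eq ⟩
        b +ₚ -ₚ b     ≡⟨ +ₚ-inverseʳ b ⟩
        ⟦ 0 ⟧         ∎)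
    [-b]²≡b² : (-ₚ b) ^ₚ 2 ≡ b ^ₚ 2
    [-b]²≡b² = solve 1 (λ b → (:- b) :^ 2 := b :^ 2) refl b
    split : ∀ y → 𝟙 (y ^ₚ 2 ≟ b ^ₚ 2) ≡ 𝟙 (y ≟ b) + 𝟙 (y ≟ -ₚ b)
    split y with y ≟ b | y ≟ -ₚ b
    ... | yes refl | yes y≡-y = contradiction y≡-y b≢-b
    ... | yes refl | no  _    = 𝟙-yes (y ^ₚ 2 ≟ y ^ₚ 2) refl
    ... | no  _    | yes y≡-b = 𝟙-yes (y ^ₚ 2 ≟ b ^ₚ 2) (trans (cong (_^ₚ 2) y≡-b) [-b]²≡b²)
    ... | no  y≢b  | no  y≢-b = 𝟙-no (y ^ₚ 2 ≟ b ^ₚ 2) ([ y≢b , y≢-b ]′ ∘ y²≡b²⇒y≡±b y b)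
  ... | nonsquare a≢0 ∄ = trans (sum-zero (λ y → 𝟙 (y ^ₚ 2 ≟ a)) (λ y → 𝟙-no (y ^ₚ 2 ≟ a) (∄ y)))
                                (cong (_+_ 1ℤ) (sym (σ-nonsquare a≢0 ∄)))

  sum-1+ : (g : 𝔽 p → ℤ) → ∑[ x < p ] (1ℤ + g x) ≡ + p + sum g
  sum-1+ g = trans (∑-distrib-+ (λ _ → 1ℤ) g) (cong (_+ sum g) (trans (sum-const p 1ℤ) (ℤ.*-identityʳ (+ p))))

  -- Double counting of the pairs (x, y) with y² = x: grouped by x they number p + Σ σ(x), grouped
  -- by y they number p.
  sum-σ : ∑[ x < p ] σ x ≡ 0ℤ
  sum-σ = ℤ-Group.∙-cancelˡ (+ p) _ _ (begin
    + p + sum {p} σ                                   ≡⟨ sum-1+ σ ⟨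
    ∑[ x < p ] (1ℤ + σ x)                             ≡⟨ sum-cong-≗ (λ x → sym (count-√ x)) ⟩
    ∑[ x < p ] ∑[ y < p ] 𝟙 (y ^ₚ 2 ≟ x)              ≡⟨ ∑-comm (λ x y → 𝟙 (y ^ₚ 2 ≟ x)) ⟩
    ∑[ y < p ] ∑[ x < p ] 𝟙 (y ^ₚ 2 ≟ x)              ≡⟨ sum-cong-≗ (λ y → sum-cong-≗ λ x → 𝟙-⇔ (mk⇔ sym sym) (y ^ₚ 2 ≟ x) (x ≟ y ^ₚ 2)) ⟩
    ∑[ y < p ] ∑[ x < p ] 𝟙 (x ≟ y ^ₚ 2)              ≡⟨ sum-cong-≗ (λ y → sum-𝟙≟ (y ^ₚ 2)) ⟩
    ∑[ y < p ] 1ℤ                                     ≡⟨ sum-const p 1ℤ ⟩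
    + p * 1ℤ                                          ≡⟨ ℤ.*-identityʳ (+ p) ⟩
    + p                                               ≡⟨ ℤ.+-identityʳ (+ p) ⟨
    + p + 0ℤ                                          ∎)
    where open ≡-Reasoning

  ^ₚ2-nonzero : (u : 𝔽 p) → u ≢ ⟦ 0 ⟧ → u ^ₚ 2 ≢ ⟦ 0 ⟧
  ^ₚ2-nonzero u u≢0 eq = u≢0 (a²≡0⇒a≡0 u eq)

  -- Multiplying or dividing a square root by u passes between `a` and u²a. This is the part of
  -- multiplicativity on which the proof of `σ-*` rests.
  σ-u²a : (u a : 𝔽 p) → u ≢ ⟦ 0 ⟧ → σ (u ^ₚ 2 *ₚ a) ≡ σ a
  σ-u²a u a u≢0 with classify a
  ... | zero refl = cong σ (*ₚ-zeroʳ (u ^ₚ 2))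
  ... | square a≢0 b refl = trans
    (σ-square (*ₚ-nonzero (u ^ₚ 2) (b ^ₚ 2) (^ₚ2-nonzero u u≢0) a≢0) (u *ₚ b)
      (solve 2 (λ u b → (u :* b) :^ 2 := u :^ 2 :* b :^ 2) refl u b))
    (sym (σ-square a≢0 b refl))
  ... | nonsquare a≢0 ∄ with u⁻¹ , uu⁻¹≡1 ← invertible u u≢0 = trans
    (σ-nonsquare (*ₚ-nonzero (u ^ₚ 2) a (^ₚ2-nonzero u u≢0) a≢0) λ b b²≡u²a → ∄ (u⁻¹ *ₚ b) (begin
      (u⁻¹ *ₚ b) ^ₚ 2              ≡⟨ solve 2 (λ i b → (i :* b) :^ 2 := i :^ 2 :* b :^ 2) refl u⁻¹ b ⟩
      u⁻¹ ^ₚ 2 *ₚ b ^ₚ 2           ≡⟨ cong (u⁻¹ ^ₚ 2 *ₚ_) b²≡u²a ⟩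
      u⁻¹ ^ₚ 2 *ₚ (u ^ₚ 2 *ₚ a)    ≡⟨ solve 3 (λ i u a → i :^ 2 :* (u :^ 2 :* a) := (u :* i) :^ 2 :* a) refl u⁻¹ u a ⟩
      (u *ₚ u⁻¹) ^ₚ 2 *ₚ a         ≡⟨ cong (λ t → t ^ₚ 2 *ₚ a) uu⁻¹≡1 ⟩
      ⟦ 1 ⟧ ^ₚ 2 *ₚ a              ≡⟨ solve 1 (λ a → con 1ℤ :^ 2 :* a := a) refl a ⟩
      a                            ∎))
    (sym (σ-nonsquare a≢0 ∄))
    where open ≡-Reasoning

  σ≤1 : (a : 𝔽 p) → σ a ≤ 1ℤ
  σ≤1 a with classify a
  ... | zero a≡0        = subst (_≤ 1ℤ) (sym (σ-zero a≡0)) (ℤ.+≤+ ℕ.z≤n)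
  ... | square a≢0 b eq = ℤ.≤-reflexive (σ-square a≢0 b eq)
  ... | nonsquare a≢0 ∄ = subst (_≤ 1ℤ) (sym (σ-nonsquare a≢0 ∄)) ℤ.-≤+

  -- Both sides sum to 0 over b, and σ (ab) + σ b ≤ 0 for every b because a times a square is a nonsquare.
  σ-nonsquare-* : (a : 𝔽 p) → a ≢ ⟦ 0 ⟧ → (∀ b → b ^ₚ 2 ≢ a) → (b : 𝔽 p) → σ (a *ₚ b) + σ b ≡ 0ℤ
  σ-nonsquare-* a a≢0 ∄ = sum-nonpos≡0 (λ b → σ (a *ₚ b) + σ b) nonpos (begin
    ∑[ b < p ] (σ (a *ₚ b) + σ b)                ≡⟨ ∑-distrib-+ (λ b → σ (a *ₚ b)) σ ⟩
    ∑[ b < p ] σ (a *ₚ b) + sum {p} σ            ≡⟨ cong (_+ sum {p} σ) (sum-cong-≗ λ b → cong σ (sym (+ₚ-identityʳ (a *ₚ b)))) ⟩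
    ∑[ b < p ] σ (a *ₚ b +ₚ ⟦ 0 ⟧) + sum {p} σ   ≡⟨ cong (_+ sum {p} σ) (sum-affine a ⟦ 0 ⟧ a≢0 σ) ⟩
    sum {p} σ + sum {p} σ                        ≡⟨ cong₂ _+_ sum-σ sum-σ ⟩
    0ℤ                                           ∎)
    where
    open ≡-Reasoning
    nonpos : ∀ b → σ (a *ₚ b) + σ b ≤ 0ℤ
    nonpos b with classify b
    ... | zero refl = ℤ.≤-reflexive (cong₂ _+_ (σ-zero (*ₚ-zeroʳ a)) (σ-zero refl))
    ... | square b≢0 c refl = ℤ.≤-reflexive (cong₂ _+_
      (trans (cong σ (*ₚ-comm a (c ^ₚ 2))) (trans (σ-u²a c a (λ { refl → b≢0 0²≡0 })) (σ-nonsquare a≢0 ∄)))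
      (σ-square b≢0 c refl))
    ... | nonsquare b≢0 ∄′ = ℤ.+-mono-≤ (σ≤1 (a *ₚ b)) (ℤ.≤-reflexive (σ-nonsquare b≢0 ∄′))

  -- A square factor is absorbed by `σ-u²a`; a nonsquare factor reverses the sign by
  -- `σ-nonsquare-*`.
  σ-* : (a b : 𝔽 p) → σ (a *ₚ b) ≡ σ a * σ b
  σ-* a b with classify a
  ... | zero refl = trans (σ-zero (*ₚ-zeroˡ b)) (cong (_* σ b) (sym (σ-zero {⟦ 0 ⟧} refl)))
  ... | square a≢0 c refl = trans (σ-u²a c b λ { refl → a≢0 0²≡0 })
    (trans (sym (ℤ.*-identityˡ (σ b))) (cong (_* σ b) (sym (σ-square a≢0 c refl))))
  ... | nonsquare a≢0 ∄ = begin
    σ (a *ₚ b)      ≡⟨ ℤ-Group.∙-cancelʳ (σ b) _ _ (trans (σ-nonsquare-* a a≢0 ∄ b) (sym (ℤ.+-inverseˡ (σ b)))) ⟩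
    - σ b           ≡⟨ ℤ.-1*i≡-i (σ b) ⟨
    -1ℤ * σ b       ≡⟨ cong (_* σ b) (σ-nonsquare a≢0 ∄) ⟨
    σ a * σ b       ∎
    where open ≡-Reasoning

  σ²≡1 : (a : 𝔽 p) → a ≢ ⟦ 0 ⟧ → σ a * σ a ≡ 1ℤ
  σ²≡1 a a≢0 with classify a
  ... | zero a≡0        = contradiction a≡0 a≢0
  ... | square _ b eq   = cong₂ _*_ (σ-square a≢0 b eq) (σ-square a≢0 b eq)
  ... | nonsquare _ ∄   = cong₂ _*_ (σ-nonsquare a≢0 ∄) (σ-nonsquare a≢0 ∄)

  -- Completing the square, 4 (z² + bz + c) = (2z + b)² - Δ, makes the roots z correspond to the
  -- square roots u = 2z + b of Δ.
  count-quadratic : (b c : 𝔽 p) →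
    ∑[ z < p ] 𝟙 (z ^ₚ 2 +ₚ b *ₚ z +ₚ c ≟ ⟦ 0 ⟧) ≡ 1ℤ + σ (b ^ₚ 2 -ₚ ⟦ 4 ⟧ *ₚ c)
  count-quadratic b c = begin
    ∑[ z < p ] 𝟙 (z ^ₚ 2 +ₚ b *ₚ z +ₚ c ≟ ⟦ 0 ⟧)      ≡⟨ sum-cong-≗ (λ z → 𝟙-⇔ (complete-square z) (z ^ₚ 2 +ₚ b *ₚ z +ₚ c ≟ ⟦ 0 ⟧) ((⟦ 2 ⟧ *ₚ z +ₚ b) ^ₚ 2 ≟ Δ)) ⟩
    ∑[ z < p ] 𝟙 ((⟦ 2 ⟧ *ₚ z +ₚ b) ^ₚ 2 ≟ Δ)         ≡⟨ sum-affine ⟦ 2 ⟧ b 2≢0 (λ u → 𝟙 (u ^ₚ 2 ≟ Δ)) ⟩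
    ∑[ u < p ] 𝟙 (u ^ₚ 2 ≟ Δ)                         ≡⟨ count-√ Δ ⟩
    1ℤ + σ Δ                                          ∎
    where
    open ≡-Reasoning
    Δ : 𝔽 p
    Δ = b ^ₚ 2 -ₚ ⟦ 4 ⟧ *ₚ c
    4q≡u²-Δ : ∀ z → ⟦ 4 ⟧ *ₚ (z ^ₚ 2 +ₚ b *ₚ z +ₚ c) ≡ (⟦ 2 ⟧ *ₚ z +ₚ b) ^ₚ 2 -ₚ Δ
    4q≡u²-Δ z = solve 3 (λ b c z → con (+ 4) :* (z :^ 2 :+ b :* z :+ c)
      := (con (+ 2) :* z :+ b) :^ 2 :- (b :^ 2 :- con (+ 4) :* c)) refl b c z
    complete-square : ∀ z → (z ^ₚ 2 +ₚ b *ₚ z +ₚ c ≡ ⟦ 0 ⟧) ⇔ ((⟦ 2 ⟧ *ₚ z +ₚ b) ^ₚ 2 ≡ Δ)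
    complete-square z = mk⇔
      (λ q≡0 → a-b≡0⇒a≡b ((⟦ 2 ⟧ *ₚ z +ₚ b) ^ₚ 2) Δ
        (trans (sym (4q≡u²-Δ z)) (trans (cong (⟦ 4 ⟧ *ₚ_) q≡0) (*ₚ-zeroʳ ⟦ 4 ⟧))))
      (λ u²≡Δ → ab≡0⇒b≡0 ⟦ 4 ⟧ (z ^ₚ 2 +ₚ b *ₚ z +ₚ c) 4≢0
        (trans (4q≡u²-Δ z) (trans (cong (_-ₚ Δ) u²≡Δ) (+ₚ-inverseʳ Δ))))

  sum-≢0 : ∑[ w < p ] (1ℤ - 𝟙 (w ≟ ⟦ 0 ⟧)) ≡ + p - 1ℤ
  sum-≢0 = begin
    ∑[ w < p ] (1ℤ - 𝟙 (w ≟ ⟦ 0 ⟧))             ≡⟨ sum-1+ (λ w → - 𝟙 (w ≟ ⟦ 0 ⟧)) ⟩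
    + p + ∑[ w < p ] (- 𝟙 (w ≟ ⟦ 0 ⟧))          ≡⟨ cong (_+_ (+ p)) (sum-cong-≗ λ w → sym (ℤ.-1*i≡-i (𝟙 (w ≟ ⟦ 0 ⟧)))) ⟩
    + p + ∑[ w < p ] (-1ℤ * 𝟙 (w ≟ ⟦ 0 ⟧))      ≡⟨ cong (_+_ (+ p)) (*-distribˡ-sum -1ℤ (λ w → 𝟙 (w ≟ ⟦ 0 ⟧))) ⟨
    + p + -1ℤ * ∑[ w < p ] 𝟙 (w ≟ ⟦ 0 ⟧)        ≡⟨ cong (λ s → + p + -1ℤ * s) (sum-𝟙≟ {p} ⟦ 0 ⟧) ⟩
    + p - 1ℤ                                    ∎
    where open ≡-Reasoning

  -- Putting v = u - w turns the hyperbola u² - v² = Δ into w (2u - w) = Δ, which determines u from w ≠ 0.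
  count-hyperbola : (Δ : 𝔽 p) → Δ ≢ ⟦ 0 ⟧ →
    ∑[ u < p ] ∑[ v < p ] 𝟙 (v ^ₚ 2 ≟ u ^ₚ 2 -ₚ Δ) ≡ + p - 1ℤ
  count-hyperbola Δ Δ≢0 = begin
    ∑[ u < p ] ∑[ v < p ] 𝟙 (v ^ₚ 2 ≟ u ^ₚ 2 -ₚ Δ)
      ≡⟨ sum-cong-≗ (λ u → sum-affine (-ₚ ⟦ 1 ⟧) u -1≢0 (λ v → 𝟙 (v ^ₚ 2 ≟ u ^ₚ 2 -ₚ Δ))) ⟨
    ∑[ u < p ] ∑[ w < p ] 𝟙 ((-ₚ ⟦ 1 ⟧ *ₚ w +ₚ u) ^ₚ 2 ≟ u ^ₚ 2 -ₚ Δ)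
      ≡⟨ ∑-comm (λ u w → 𝟙 ((-ₚ ⟦ 1 ⟧ *ₚ w +ₚ u) ^ₚ 2 ≟ u ^ₚ 2 -ₚ Δ)) ⟩
    ∑[ w < p ] ∑[ u < p ] 𝟙 ((-ₚ ⟦ 1 ⟧ *ₚ w +ₚ u) ^ₚ 2 ≟ u ^ₚ 2 -ₚ Δ)
      ≡⟨ sum-cong-≗ (λ w → sum-cong-≗ λ u → 𝟙-⇔ (linear w u) ((-ₚ ⟦ 1 ⟧ *ₚ w +ₚ u) ^ₚ 2 ≟ u ^ₚ 2 -ₚ Δ) (⟦ 2 ⟧ *ₚ w *ₚ u +ₚ -ₚ (w ^ₚ 2 +ₚ Δ) ≟ ⟦ 0 ⟧)) ⟩
    ∑[ w < p ] ∑[ u < p ] 𝟙 (⟦ 2 ⟧ *ₚ w *ₚ u +ₚ -ₚ (w ^ₚ 2 +ₚ Δ) ≟ ⟦ 0 ⟧)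
      ≡⟨ sum-cong-≗ one-u ⟩
    ∑[ w < p ] (1ℤ - 𝟙 (w ≟ ⟦ 0 ⟧))
      ≡⟨ sum-≢0 ⟩
    + p - 1ℤ ∎
    where
    open ≡-Reasoning
    -1≢0 : -ₚ ⟦ 1 ⟧ ≢ ⟦_⟧ {p} 0
    -1≢0 eq = 2≢0 (begin
      ⟦ 2 ⟧                          ≡⟨ solve 0 (con (+ 2) := (:- con 1ℤ) :* (:- con (+ 2))) refl ⟩
      -ₚ ⟦ 1 ⟧ *ₚ -ₚ ⟦ 2 ⟧           ≡⟨ cong (_*ₚ -ₚ ⟦ 2 ⟧) eq ⟩
      ⟦ 0 ⟧ *ₚ -ₚ ⟦ 2 ⟧              ≡⟨ *ₚ-zeroˡ (-ₚ ⟦ 2 ⟧) ⟩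
      ⟦ 0 ⟧                          ∎)
    expand : ∀ w u → (u ^ₚ 2 -ₚ Δ) -ₚ (-ₚ ⟦ 1 ⟧ *ₚ w +ₚ u) ^ₚ 2 ≡ ⟦ 2 ⟧ *ₚ w *ₚ u +ₚ -ₚ (w ^ₚ 2 +ₚ Δ)
    expand w u = solve 3 (λ w u Δ → (u :^ 2 :- Δ) :- ((:- con 1ℤ) :* w :+ u) :^ 2
      := con (+ 2) :* w :* u :+ (:- (w :^ 2 :+ Δ))) refl w u Δ
    linear : ∀ w u → ((-ₚ ⟦ 1 ⟧ *ₚ w +ₚ u) ^ₚ 2 ≡ u ^ₚ 2 -ₚ Δ) ⇔ (⟦ 2 ⟧ *ₚ w *ₚ u +ₚ -ₚ (w ^ₚ 2 +ₚ Δ) ≡ ⟦ 0 ⟧)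
    linear w u = mk⇔
      (λ eq → trans (sym (expand w u)) (trans (cong (_-ₚ_ (u ^ₚ 2 -ₚ Δ)) eq) (+ₚ-inverseʳ (u ^ₚ 2 -ₚ Δ))))
      (λ eq → sym (a-b≡0⇒a≡b (u ^ₚ 2 -ₚ Δ) ((-ₚ ⟦ 1 ⟧ *ₚ w +ₚ u) ^ₚ 2) (trans (expand w u) eq)))
    one-u : ∀ w → ∑[ u < p ] 𝟙 (⟦ 2 ⟧ *ₚ w *ₚ u +ₚ -ₚ (w ^ₚ 2 +ₚ Δ) ≟ ⟦ 0 ⟧) ≡ 1ℤ - 𝟙 (w ≟ ⟦ 0 ⟧)
    one-u w with w ≟ ⟦ 0 ⟧
    ... | no w≢0 = sum-𝟙-affine (⟦ 2 ⟧ *ₚ w) (-ₚ (w ^ₚ 2 +ₚ Δ)) (*ₚ-nonzero ⟦ 2 ⟧ w 2≢0 w≢0)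
    ... | yes refl = sum-zero (λ u → 𝟙 (⟦ 2 ⟧ *ₚ ⟦ 0 ⟧ *ₚ u +ₚ -ₚ (⟦ 0 ⟧ ^ₚ 2 +ₚ Δ) ≟ ⟦ 0 ⟧))
      λ u → 𝟙-no (⟦ 2 ⟧ *ₚ ⟦ 0 ⟧ *ₚ u +ₚ -ₚ (⟦ 0 ⟧ ^ₚ 2 +ₚ Δ) ≟ ⟦ 0 ⟧) λ eq → Δ≢0 (begin
        Δ              ≡⟨ solve 2 (λ u Δ → Δ := (:- con 1ℤ) :* (con (+ 2) :* con 0ℤ :* u :+ (:- (con 0ℤ :^ 2 :+ Δ)))) refl u Δ ⟩
        -ₚ ⟦ 1 ⟧ *ₚ (⟦ 2 ⟧ *ₚ ⟦ 0 ⟧ *ₚ u +ₚ -ₚ (⟦ 0 ⟧ ^ₚ 2 +ₚ Δ))   ≡⟨ cong (-ₚ ⟦ 1 ⟧ *ₚ_) eq ⟩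
        -ₚ ⟦ 1 ⟧ *ₚ ⟦ 0 ⟧        ≡⟨ *ₚ-zeroʳ (-ₚ ⟦ 1 ⟧) ⟩
        ⟦ 0 ⟧          ∎)

  -- For Δ = 0 every u ≠ 0 contributes 1. Otherwise 1 + σ(u² - Δ) counts the v with v² = u² - Δ, so
  -- p plus the sum is the number p - 1 of points of the hyperbola.
  sum-σ-shifted-square : (Δ : 𝔽 p) → ∑[ u < p ] σ (u ^ₚ 2 -ₚ Δ) ≡ + p * 𝟙 (Δ ≟ ⟦ 0 ⟧) - 1ℤ
  sum-σ-shifted-square Δ with Δ ≟ ⟦ 0 ⟧
  ... | yes refl = begin
    ∑[ u < p ] σ (u ^ₚ 2 -ₚ ⟦ 0 ⟧)          ≡⟨ sum-cong-≗ σ-u² ⟩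
    ∑[ u < p ] (1ℤ - 𝟙 (u ≟ ⟦ 0 ⟧))         ≡⟨ sum-≢0 ⟩
    + p - 1ℤ                                ≡⟨ cong (_- 1ℤ) (ℤ.*-identityʳ (+ p)) ⟨
    + p * 1ℤ - 1ℤ                           ∎
    where
    open ≡-Reasoning
    u²-0≡u² : ∀ u → u ^ₚ 2 -ₚ ⟦ 0 ⟧ ≡ u ^ₚ 2
    u²-0≡u² u = solve 1 (λ u → u :^ 2 :- con 0ℤ := u :^ 2) refl u
    σ-u² : ∀ u → σ (u ^ₚ 2 -ₚ ⟦ 0 ⟧) ≡ 1ℤ - 𝟙 (u ≟ ⟦ 0 ⟧)
    σ-u² u with u ≟ ⟦ 0 ⟧
    ... | yes refl = σ-zero (trans (u²-0≡u² ⟦ 0 ⟧) 0²≡0)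
    ... | no u≢0   = trans (cong σ (u²-0≡u² u)) (σ-square (^ₚ2-nonzero u u≢0) u refl)
  ... | no Δ≢0 = ℤ-Group.∙-cancelˡ (+ p) _ _ (begin
    + p + ∑[ u < p ] σ (u ^ₚ 2 -ₚ Δ)                       ≡⟨ sum-1+ (λ u → σ (u ^ₚ 2 -ₚ Δ)) ⟨
    ∑[ u < p ] (1ℤ + σ (u ^ₚ 2 -ₚ Δ))                      ≡⟨ sum-cong-≗ (λ u → sym (count-√ (u ^ₚ 2 -ₚ Δ))) ⟩
    ∑[ u < p ] ∑[ v < p ] 𝟙 (v ^ₚ 2 ≟ u ^ₚ 2 -ₚ Δ)         ≡⟨ count-hyperbola Δ Δ≢0 ⟩
    + p - 1ℤ                                               ≡⟨ cong (λ t → + p + (t - 1ℤ)) (ℤ.*-zeroʳ (+ p)) ⟨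
    + p + (+ p * 0ℤ - 1ℤ)                                  ∎)
    where open ≡-Reasoning

  -- Since 4a · q(y) = (2ay + b)² - Δ and σ(a)² = 1, the factor σ(a) comes out and the substitution
  -- u = 2ay + b leaves a shifted square.
  sum-σ-quadratic : (a b c : 𝔽 p) → a ≢ ⟦ 0 ⟧ →
    ∑[ y < p ] σ (a *ₚ y ^ₚ 2 +ₚ b *ₚ y +ₚ c) ≡ σ a * (+ p * 𝟙 (b ^ₚ 2 -ₚ ⟦ 4 ⟧ *ₚ a *ₚ c ≟ ⟦ 0 ⟧) - 1ℤ)
  sum-σ-quadratic a b c a≢0 = begin
    ∑[ y < p ] σ (q y)                                    ≡⟨ sum-cong-≗ σ-q ⟩
    ∑[ y < p ] (σ a * σ ((⟦ 2 ⟧ *ₚ a *ₚ y +ₚ b) ^ₚ 2 -ₚ Δ))   ≡⟨ *-distribˡ-sum (σ a) (λ y → σ ((⟦ 2 ⟧ *ₚ a *ₚ y +ₚ b) ^ₚ 2 -ₚ Δ)) ⟨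
    σ a * ∑[ y < p ] σ ((⟦ 2 ⟧ *ₚ a *ₚ y +ₚ b) ^ₚ 2 -ₚ Δ)     ≡⟨ cong (_*_ (σ a)) (sum-affine (⟦ 2 ⟧ *ₚ a) b (*ₚ-nonzero ⟦ 2 ⟧ a 2≢0 a≢0) (λ u → σ (u ^ₚ 2 -ₚ Δ))) ⟩
    σ a * ∑[ u < p ] σ (u ^ₚ 2 -ₚ Δ)                      ≡⟨ cong (_*_ (σ a)) (sum-σ-shifted-square Δ) ⟩
    σ a * (+ p * 𝟙 (Δ ≟ ⟦ 0 ⟧) - 1ℤ)                      ∎
    where
    open ≡-Reasoning
    Δ : 𝔽 p
    Δ = b ^ₚ 2 -ₚ ⟦ 4 ⟧ *ₚ a *ₚ c
    q : 𝔽 p → 𝔽 p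
    q y = a *ₚ y ^ₚ 2 +ₚ b *ₚ y +ₚ c
    σ-q : ∀ y → σ (q y) ≡ σ a * σ ((⟦ 2 ⟧ *ₚ a *ₚ y +ₚ b) ^ₚ 2 -ₚ Δ)
    σ-q y = begin
      σ (q y)                          ≡⟨ ℤ.*-identityˡ (σ (q y)) ⟨
      1ℤ * σ (q y)                     ≡⟨ cong (_* σ (q y)) (σ²≡1 a a≢0) ⟨
      σ a * σ a * σ (q y)              ≡⟨ ℤ.*-assoc (σ a) (σ a) (σ (q y)) ⟩
      σ a * (σ a * σ (q y))            ≡⟨ cong (_*_ (σ a)) (σ-* a (q y)) ⟨
      σ a * σ (a *ₚ q y)               ≡⟨ cong (_*_ (σ a)) (σ-u²a ⟦ 2 ⟧ (a *ₚ q y) 2≢0) ⟨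
      σ a * σ (⟦ 2 ⟧ ^ₚ 2 *ₚ (a *ₚ q y))   ≡⟨ cong (λ t → σ a * σ t) (solve 4 (λ a b c y →
          con (+ 2) :^ 2 :* (a :* (a :* y :^ 2 :+ b :* y :+ c))
            := (con (+ 2) :* a :* y :+ b) :^ 2 :- (b :^ 2 :- con (+ 4) :* a :* c)) refl a b c y) ⟩
      σ a * σ ((⟦ 2 ⟧ *ₚ a *ₚ y +ₚ b) ^ₚ 2 -ₚ Δ)  ∎

  sum-σ-affine : (a b : 𝔽 p) → a ≢ ⟦ 0 ⟧ → ∑[ y < p ] σ (a *ₚ y +ₚ b) ≡ 0ℤ
  sum-σ-affine a b a≢0 = trans (sum-affine a b a≢0 σ) sum-σ

-- Slicing the surface by x.

module CubicSurface {p : ℕ} .{{_ : NonZero p}} (prime : Prime p) (2≢0 : ⟦_⟧ {p} 2 ≢ ⟦ 0 ⟧) (C D : 𝔽 p) where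

  open OddPrimeField prime 2≢0

  private
    module _ {n} (C D : Polynomial n) where
      κᴾ : Polynomial n → Polynomial n
      κᴾ x = x :^ 3 :+ (C :- con (+ 2)) :* x :^ 2 :- (con (+ 2) :* C :+ D) :* x :+ C :^ 2 :+ con (+ 2) :* D

      discᴾ : Polynomial n → Polynomial n → Polynomial n
      discᴾ x y = (x :^ 2 :- con (+ 4)) :* y :^ 2 :+ (:- (con (+ 2) :* C :* x :+ con (+ 4) :* C)) :* y
        :+ (C :^ 2 :- con (+ 4) :* (x :^ 2 :+ C :* x :- D))

      -- The factor 4 clears the quotient C²/4 in `D•`, leaving a polynomial with integer
      -- coefficients.
      4Eᴾ : Polynomial n
      4Eᴾ = con (+ 4) :* D :- con (+ 16) :+ con (+ 8) :* C :+ C :^ 2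

  -- disc x y is the discriminant of f C D x y z as a quadratic polynomial in z.
  disc : 𝔽 p → 𝔽 p → 𝔽 p
  disc x y = (x ^ₚ 2 -ₚ ⟦ 4 ⟧) *ₚ y ^ₚ 2 +ₚ -ₚ (⟦ 2 ⟧ *ₚ C *ₚ x +ₚ ⟦ 4 ⟧ *ₚ C) *ₚ y
             +ₚ (C ^ₚ 2 -ₚ ⟦ 4 ⟧ *ₚ (x ^ₚ 2 +ₚ C *ₚ x -ₚ D))

  count-z : ∀ x y → ∑[ z < p ] 𝟙 (f C D x y z ≟ ⟦ 0 ⟧) ≡ 1ℤ + σ (disc x y)
  count-z x y = begin
    ∑[ z < p ] 𝟙 (f C D x y z ≟ ⟦ 0 ⟧)                 ≡⟨ sum-cong-≗ (λ z → cong (λ t → 𝟙 (t ≟ ⟦ 0 ⟧)) (in-z z)) ⟩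
    ∑[ z < p ] 𝟙 (z ^ₚ 2 +ₚ b *ₚ z +ₚ c ≟ ⟦ 0 ⟧)       ≡⟨ count-quadratic b c ⟩
    1ℤ + σ (b ^ₚ 2 -ₚ ⟦ 4 ⟧ *ₚ c)                      ≡⟨ cong (λ t → 1ℤ + σ t) b²-4c≡disc ⟩
    1ℤ + σ (disc x y)                                  ∎
    where
    open ≡-Reasoning
    b c : 𝔽 p
    b = C -ₚ x *ₚ y
    c = x ^ₚ 2 +ₚ y ^ₚ 2 +ₚ C *ₚ (x +ₚ y) -ₚ D
    in-z : ∀ z → f C D x y z ≡ z ^ₚ 2 +ₚ b *ₚ z +ₚ c
    in-z z = solve 5 (λ C D x y z →
      x :^ 2 :+ y :^ 2 :+ z :^ 2 :- x :* y :* z :+ C :* (x :+ y :+ z) :- D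
        := z :^ 2 :+ (C :- x :* y) :* z :+ (x :^ 2 :+ y :^ 2 :+ C :* (x :+ y) :- D)) refl C D x y z
    b²-4c≡disc : b ^ₚ 2 -ₚ ⟦ 4 ⟧ *ₚ c ≡ disc x y
    b²-4c≡disc = solve 4 (λ C D x y →
      (C :- x :* y) :^ 2 :- con (+ 4) :* (x :^ 2 :+ y :^ 2 :+ C :* (x :+ y) :- D)
        := discᴾ C D x y) refl C D x y

  -- The deviation from p: the slice of the surface at `x` has p + `fibre x` points.
  fibre : 𝔽 p → ℤ
  fibre x = ∑[ y < p ] σ (disc x y)

  N₀³-fibres : + N₀³ (f C D) ≡ + (p ℕ.^ 2) + sum fibre
  N₀³-fibres = begin
    + N₀³ (f C D)
      ≡⟨ length-filter-cartesianProduct (λ (x , y , z) → f C D x y z ≟ ⟦ 0 ⟧) id (cartesianProduct (allFin p) (allFin p)) ⟩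
    ∑[ x < p ] (+ length (filter (λ (y , z) → f C D x y z ≟ ⟦ 0 ⟧) (cartesianProduct (allFin p) (allFin p))))
      ≡⟨ sum-cong-≗ (λ x → length-filter-cartesianProduct (λ (y , z) → f C D x y z ≟ ⟦ 0 ⟧) id (allFin p)) ⟩
    ∑[ x < p ] ∑[ y < p ] (+ length (filter (λ z → f C D x y z ≟ ⟦ 0 ⟧) (allFin p)))
      ≡⟨ sum-cong-≗ (λ x → sum-cong-≗ λ y → trans (length-filter-tabulate (λ z → f C D x y z ≟ ⟦ 0 ⟧) id) (count-z x y)) ⟩
    ∑[ x < p ] ∑[ y < p ] (1ℤ + σ (disc x y))
      ≡⟨ sum-cong-≗ (λ x → sum-1+ (λ y → σ (disc x y))) ⟩
    ∑[ x < p ] (+ p + fibre x)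
      ≡⟨ ∑-distrib-+ (λ _ → + p) fibre ⟩
    ∑[ x < p ] (+ p) + sum fibre
      ≡⟨ cong (_+ sum fibre) (sum-const p (+ p)) ⟩
    + p * + p + sum fibre
      ≡⟨ cong (_+ sum fibre) (ℤ.pos-* p p) ⟨
    + (p ℕ.* p) + sum fibre
      ≡⟨ cong (λ k → + (p ℕ.* k) + sum fibre) (ℕ.*-identityʳ p) ⟨
    + (p ℕ.^ 2) + sum fibre ∎
    where open ≡-Reasoning

  -- Both cases of the theorem share the correction -σ(x² - 4), which is 0 at x = ±2 and totals 1
  -- because 4 ≠ 0; they differ only in the coefficient `T` of p.
  N₀³-from-fibres : (T : 𝔽 p → ℤ) → (∀ x → fibre x ≡ + p * T x - σ (x ^ₚ 2 -ₚ ⟦ 4 ⟧)) →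
    + N₀³ (f C D) ≡ + (p ℕ.^ 2) + 1ℤ + sum T * + p
  N₀³-from-fibres T fibre≡ = begin
    + N₀³ (f C D)                                                   ≡⟨ N₀³-fibres ⟩
    + (p ℕ.^ 2) + sum fibre                                         ≡⟨ cong (_+_ (+ (p ℕ.^ 2))) (sum-cong-≗ λ x → trans (fibre≡ x) (cong (_+_ (+ p * T x)) (sym (ℤ.-1*i≡-i (σ (x ^ₚ 2 -ₚ ⟦ 4 ⟧)))))) ⟩
    + (p ℕ.^ 2) + ∑[ x < p ] (+ p * T x + -1ℤ * σ (x ^ₚ 2 -ₚ ⟦ 4 ⟧))       ≡⟨ cong (_+_ (+ (p ℕ.^ 2))) (∑-distrib-+ (λ x → + p * T x) (λ x → -1ℤ * σ (x ^ₚ 2 -ₚ ⟦ 4 ⟧))) ⟩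
    + (p ℕ.^ 2) + (∑[ x < p ] (+ p * T x) + ∑[ x < p ] (-1ℤ * σ (x ^ₚ 2 -ₚ ⟦ 4 ⟧)))   ≡⟨ cong (_+_ (+ (p ℕ.^ 2))) (cong₂ _+_ (*-distribˡ-sum (+ p) T) (*-distribˡ-sum -1ℤ (λ x → σ (x ^ₚ 2 -ₚ ⟦ 4 ⟧)))) ⟨
    + (p ℕ.^ 2) + (+ p * sum T + -1ℤ * ∑[ x < p ] σ (x ^ₚ 2 -ₚ ⟦ 4 ⟧))      ≡⟨ cong (λ s → + (p ℕ.^ 2) + (+ p * sum T + -1ℤ * s)) sum-σ-x²-4 ⟩
    + (p ℕ.^ 2) + (+ p * sum T + 1ℤ)                                ≡⟨ rearrange (+ (p ℕ.^ 2)) (+ p) (sum T) ⟩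
    + (p ℕ.^ 2) + 1ℤ + sum T * + p                                  ∎
    where
    open ≡-Reasoning
    sum-σ-x²-4 : ∑[ x < p ] σ (x ^ₚ 2 -ₚ ⟦ 4 ⟧) ≡ -1ℤ
    sum-σ-x²-4 = trans (sum-σ-shifted-square ⟦ 4 ⟧)
      (cong (_- 1ℤ) (trans (cong (_*_ (+ p)) (𝟙-no (⟦ 4 ⟧ ≟ ⟦ 0 ⟧) 4≢0)) (ℤ.*-zeroʳ (+ p))))
    rearrange : ∀ a b c → a + (b * c + 1ℤ) ≡ a + 1ℤ + c * b
    rearrange = solve-∀

  -- The parameter E, the generic fibres and the fibres over ±2.

  E : 𝔽 p
  E = D -ₚ D• C

  -- The one place where the quotient in `D•` is opened: `inv ⟦ 4 ⟧` is an atom for the solver, and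
  -- its product with 4 is then replaced by 1.
  4E : ⟦ 4 ⟧ *ₚ E ≡ ⟦ 4 ⟧ *ₚ D -ₚ ⟦ 16 ⟧ +ₚ ⟦ 8 ⟧ *ₚ C +ₚ C ^ₚ 2
  4E = begin
    ⟦ 4 ⟧ *ₚ E
      ≡⟨ solve 3 (λ C D i → con (+ 4) :* (D :- (con (+ 4) :- con (+ 2) :* C :- C :^ 2 :* i))
           := con (+ 4) :* D :- con (+ 16) :+ con (+ 8) :* C :+ C :^ 2 :* (con (+ 4) :* i)) refl C D (inv ⟦ 4 ⟧) ⟩
    ⟦ 4 ⟧ *ₚ D -ₚ ⟦ 16 ⟧ +ₚ ⟦ 8 ⟧ *ₚ C +ₚ C ^ₚ 2 *ₚ (⟦ 4 ⟧ *ₚ inv ⟦ 4 ⟧)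
      ≡⟨ cong (λ t → ⟦ 4 ⟧ *ₚ D -ₚ ⟦ 16 ⟧ +ₚ ⟦ 8 ⟧ *ₚ C +ₚ C ^ₚ 2 *ₚ t) (*ₚ-inverseʳ ⟦ 4 ⟧ 4≢0) ⟩
    ⟦ 4 ⟧ *ₚ D -ₚ ⟦ 16 ⟧ +ₚ ⟦ 8 ⟧ *ₚ C +ₚ C ^ₚ 2 *ₚ ⟦ 1 ⟧
      ≡⟨ cong (λ t → ⟦ 4 ⟧ *ₚ D -ₚ ⟦ 16 ⟧ +ₚ ⟦ 8 ⟧ *ₚ C +ₚ t) (*ₚ-identityʳ (C ^ₚ 2)) ⟩
    ⟦ 4 ⟧ *ₚ D -ₚ ⟦ 16 ⟧ +ₚ ⟦ 8 ⟧ *ₚ C +ₚ C ^ₚ 2 ∎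
    where open ≡-Reasoning

  σ-4E : ∀ {t} → t ≡ ⟦ 4 ⟧ *ₚ E → σ t ≡ σ E
  σ-4E {t} t≡4E = trans (cong σ (trans t≡4E (solve 1 (λ e → con (+ 4) :* e := con (+ 2) :^ 2 :* e) refl E))) (σ-u²a ⟦ 2 ⟧ E 2≢0)

  x²≡4⇒x≡±2 : ∀ x → x ^ₚ 2 -ₚ ⟦ 4 ⟧ ≡ ⟦ 0 ⟧ → x ≡ ⟦ 2 ⟧ ⊎ x ≡ -ₚ ⟦ 2 ⟧
  x²≡4⇒x≡±2 x eq = y²≡b²⇒y≡±b x ⟦ 2 ⟧ (trans (a-b≡0⇒a≡b (x ^ₚ 2) ⟦ 4 ⟧ eq) (solve 0 (con (+ 4) := con (+ 2) :^ 2) refl))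

  [±2]²-4≡0 : ∀ {x} → x ≡ ⟦ 2 ⟧ ⊎ x ≡ -ₚ ⟦ 2 ⟧ → x ^ₚ 2 -ₚ ⟦ 4 ⟧ ≡ ⟦ 0 ⟧
  [±2]²-4≡0 (inj₁ refl) = solve 0 (con (+ 2) :^ 2 :- con (+ 4) := con 0ℤ) refl
  [±2]²-4≡0 (inj₂ refl) = solve 0 ((:- con (+ 2)) :^ 2 :- con (+ 4) := con 0ℤ) refl

  trichotomy : ∀ x → x ≡ ⟦ 2 ⟧ ⊎ x ≡ -ₚ ⟦ 2 ⟧ ⊎ x ^ₚ 2 -ₚ ⟦ 4 ⟧ ≢ ⟦ 0 ⟧
  trichotomy x with x ^ₚ 2 -ₚ ⟦ 4 ⟧ ≟ ⟦ 0 ⟧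
  ... | yes x²-4≡0 = Sum.map₂ inj₁ (x²≡4⇒x≡±2 x x²-4≡0)
  ... | no  x²-4≢0 = inj₂ (inj₂ x²-4≢0)

  x-2≢0 : ∀ x → x ^ₚ 2 -ₚ ⟦ 4 ⟧ ≢ ⟦ 0 ⟧ → x -ₚ ⟦ 2 ⟧ ≢ ⟦ 0 ⟧
  x-2≢0 x x²-4≢0 x-2≡0 = x²-4≢0 ([±2]²-4≡0 (inj₁ (a-b≡0⇒a≡b x ⟦ 2 ⟧ x-2≡0)))

  x+2≢0 : ∀ x → x ^ₚ 2 -ₚ ⟦ 4 ⟧ ≢ ⟦ 0 ⟧ → x +ₚ ⟦ 2 ⟧ ≢ ⟦ 0 ⟧
  x+2≢0 x x²-4≢0 x+2≡0 = x²-4≢0 ([±2]²-4≡0 (inj₂ (a-b≡0⇒a≡b x (-ₚ ⟦ 2 ⟧)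
    (trans (solve 1 (λ x → x :- (:- con (+ 2)) := x :+ con (+ 2)) refl x) x+2≡0))))

  2≢-2 : ⟦ 2 ⟧ ≢ -ₚ ⟦_⟧ {p} 2
  2≢-2 eq = 4≢0 (trans (solve 0 (con (+ 4) := con (+ 2) :+ con (+ 2)) refl)
    (trans (cong (⟦ 2 ⟧ +ₚ_) eq) (+ₚ-inverseʳ ⟦ 2 ⟧)))

  -- The y-discriminant of disc x y is 16 (x + 2) κ(x).
  fibre-generic : ∀ x → x ^ₚ 2 -ₚ ⟦ 4 ⟧ ≢ ⟦ 0 ⟧ →
    fibre x ≡ σ (x ^ₚ 2 -ₚ ⟦ 4 ⟧) * (+ p * 𝟙 (κ C D x ≟ ⟦ 0 ⟧) - 1ℤ)
  fibre-generic x x²-4≢0 = trans (sum-σ-quadratic a b c x²-4≢0)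
    (cong (λ t → σ a * (+ p * t - 1ℤ)) (𝟙-⇔ (mk⇔
      (λ Δ≡0 → ab≡0⇒b≡0 (⟦ 16 ⟧ *ₚ (x +ₚ ⟦ 2 ⟧)) (κ C D x) 16[x+2]≢0 (trans (sym Δ≡) Δ≡0))
      (λ κ≡0 → trans Δ≡ (trans (cong (⟦ 16 ⟧ *ₚ (x +ₚ ⟦ 2 ⟧) *ₚ_) κ≡0) (*ₚ-zeroʳ (⟦ 16 ⟧ *ₚ (x +ₚ ⟦ 2 ⟧))))))
      (b ^ₚ 2 -ₚ ⟦ 4 ⟧ *ₚ a *ₚ c ≟ ⟦ 0 ⟧) (κ C D x ≟ ⟦ 0 ⟧)))
    where
    a b c : 𝔽 p
    a = x ^ₚ 2 -ₚ ⟦ 4 ⟧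
    b = -ₚ (⟦ 2 ⟧ *ₚ C *ₚ x +ₚ ⟦ 4 ⟧ *ₚ C)
    c = C ^ₚ 2 -ₚ ⟦ 4 ⟧ *ₚ (x ^ₚ 2 +ₚ C *ₚ x -ₚ D)
    Δ≡ : b ^ₚ 2 -ₚ ⟦ 4 ⟧ *ₚ a *ₚ c ≡ ⟦ 16 ⟧ *ₚ (x +ₚ ⟦ 2 ⟧) *ₚ κ C D x
    Δ≡ = solve 3 (λ C D x →
      (:- (con (+ 2) :* C :* x :+ con (+ 4) :* C)) :^ 2
        :- con (+ 4) :* (x :^ 2 :- con (+ 4)) :* (C :^ 2 :- con (+ 4) :* (x :^ 2 :+ C :* x :- D))
      := con (+ 16) :* (x :+ con (+ 2)) :*
        κᴾ C D x)
      refl C D x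
    16≢0 : ⟦ 16 ⟧ ≢ ⟦_⟧ {p} 0
    16≢0 eq = ^ₚ2-nonzero ⟦ 4 ⟧ 4≢0 (trans (solve 0 (con (+ 4) :^ 2 := con (+ 16)) refl) eq)
    16[x+2]≢0 : ⟦ 16 ⟧ *ₚ (x +ₚ ⟦ 2 ⟧) ≢ ⟦ 0 ⟧
    16[x+2]≢0 = *ₚ-nonzero ⟦ 16 ⟧ (x +ₚ ⟦ 2 ⟧) 16≢0 (x+2≢0 x x²-4≢0)

  -- At x = -2 the coefficients x² - 4 of y² and -2C(x + 2) of y both vanish, so `disc` is the
  -- constant 4E.
  fibre[-2] : fibre (-ₚ ⟦ 2 ⟧) ≡ + p * σ E
  fibre[-2] = trans (sum-cong-≗ λ y → σ-4E (trans (disc[-2] y) (sym 4E))) (sum-const p (σ E))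
    where
    disc[-2] : ∀ y → disc (-ₚ ⟦ 2 ⟧) y ≡ ⟦ 4 ⟧ *ₚ D -ₚ ⟦ 16 ⟧ +ₚ ⟦ 8 ⟧ *ₚ C +ₚ C ^ₚ 2
    disc[-2] y = solve 3 (λ C D y → discᴾ C D (:- con (+ 2)) y
      := 4Eᴾ C D) refl C D y

  -- Explains `D•`: -2 is a root of `κ` exactly when E = 0. For E ≠ 0 the contribution of the fibre
  -- over -2 is therefore separate from those of the roots of `κ`.
  κ[-2] : κ C D (-ₚ ⟦ 2 ⟧) ≡ ⟦ 4 ⟧ *ₚ E
  κ[-2] = trans (solve 2 (λ C D → κᴾ C D (:- con (+ 2))
      := 4Eᴾ C D) refl C D) (sym 4E)

  κ[2] : κ C D ⟦ 2 ⟧ ≡ C ^ₚ 2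
  κ[2] = solve 2 (λ C D → κᴾ C D (con (+ 2)) := C :^ 2) refl C D

  -- At x = 2 the y² term vanishes and `disc` is 4E - 8C(y + 2): the constant 4E if C = 0, and
  -- otherwise affine of nonzero slope, with character sum 0. As κ(2) = C², the indicator of the
  -- root 2 tells the two cases apart.
  fibre[2]-C≡0 : C ≡ ⟦ 0 ⟧ → fibre ⟦ 2 ⟧ ≡ + p * (σ E * 𝟙 (κ C D ⟦ 2 ⟧ ≟ ⟦ 0 ⟧))
  fibre[2]-C≡0 C≡0 = begin
    fibre ⟦ 2 ⟧                                   ≡⟨ sum-cong-≗ (λ y → σ-4E (disc≡4E y)) ⟩
    ∑[ y < p ] σ E                                ≡⟨ sum-const p (σ E) ⟩
    + p * σ E                                     ≡⟨ cong (_*_ (+ p)) (ℤ.*-identityʳ (σ E)) ⟨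
    + p * (σ E * 1ℤ)                              ≡⟨ cong (λ t → + p * (σ E * t)) (𝟙-yes (κ C D ⟦ 2 ⟧ ≟ ⟦ 0 ⟧) κ≡0) ⟨
    + p * (σ E * 𝟙 (κ C D ⟦ 2 ⟧ ≟ ⟦ 0 ⟧))         ∎
    where
    open ≡-Reasoning
    κ≡0 : κ C D ⟦ 2 ⟧ ≡ ⟦ 0 ⟧
    κ≡0 = trans κ[2] (trans (cong (_^ₚ 2) C≡0) 0²≡0)
    disc≡4E : ∀ y → disc ⟦ 2 ⟧ y ≡ ⟦ 4 ⟧ *ₚ E
    disc≡4E y = begin
      disc ⟦ 2 ⟧ y
        ≡⟨ solve 3 (λ C D y → discᴾ C D (con (+ 2)) y
             := 4Eᴾ C D
                :- C :* (con (+ 8) :* y :+ con (+ 16))) refl C D y ⟩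
      (⟦ 4 ⟧ *ₚ D -ₚ ⟦ 16 ⟧ +ₚ ⟦ 8 ⟧ *ₚ C +ₚ C ^ₚ 2) -ₚ C *ₚ (⟦ 8 ⟧ *ₚ y +ₚ ⟦ 16 ⟧)
        ≡⟨ cong₂ (λ s t → s -ₚ t *ₚ (⟦ 8 ⟧ *ₚ y +ₚ ⟦ 16 ⟧)) (sym 4E) C≡0 ⟩
      ⟦ 4 ⟧ *ₚ E -ₚ ⟦ 0 ⟧ *ₚ (⟦ 8 ⟧ *ₚ y +ₚ ⟦ 16 ⟧)
        ≡⟨ solve 2 (λ e y → con (+ 4) :* e :- con 0ℤ :* (con (+ 8) :* y :+ con (+ 16)) := con (+ 4) :* e) refl E y ⟩
      ⟦ 4 ⟧ *ₚ E ∎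

  fibre[2]-C≢0 : C ≢ ⟦ 0 ⟧ → fibre ⟦ 2 ⟧ ≡ + p * (σ E * 𝟙 (κ C D ⟦ 2 ⟧ ≟ ⟦ 0 ⟧))
  fibre[2]-C≢0 C≢0 = begin
    fibre ⟦ 2 ⟧                                   ≡⟨ sum-cong-≗ (λ y → cong σ (disc-affine y)) ⟩
    ∑[ y < p ] σ (a *ₚ y +ₚ b)                    ≡⟨ sum-σ-affine a b a≢0 ⟩
    0ℤ                                            ≡⟨ ℤ.*-zeroʳ (+ p) ⟨
    + p * 0ℤ                                      ≡⟨ cong (_*_ (+ p)) (ℤ.*-zeroʳ (σ E)) ⟨
    + p * (σ E * 0ℤ)                              ≡⟨ cong (λ t → + p * (σ E * t)) (𝟙-no (κ C D ⟦ 2 ⟧ ≟ ⟦ 0 ⟧) κ≢0) ⟨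
    + p * (σ E * 𝟙 (κ C D ⟦ 2 ⟧ ≟ ⟦ 0 ⟧))         ∎
    where
    open ≡-Reasoning
    a b : 𝔽 p
    a = ⟦ 4 ⟧ *ₚ (-ₚ ⟦ 2 ⟧ *ₚ C)
    b = C ^ₚ 2 -ₚ ⟦ 4 ⟧ *ₚ (⟦ 4 ⟧ +ₚ ⟦ 2 ⟧ *ₚ C -ₚ D)
    disc-affine : ∀ y → disc ⟦ 2 ⟧ y ≡ a *ₚ y +ₚ b
    disc-affine y = solve 3 (λ C D y → discᴾ C D (con (+ 2)) y
      := con (+ 4) :* ((:- con (+ 2)) :* C) :* y
        :+ (C :^ 2 :- con (+ 4) :* (con (+ 4) :+ con (+ 2) :* C :- D))) refl C D y
    -2≢0 : -ₚ ⟦ 2 ⟧ ≢ ⟦_⟧ {p} 0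
    -2≢0 eq = ^ₚ2-nonzero ⟦ 2 ⟧ 2≢0 (trans (solve 0 (con (+ 2) :^ 2 := (:- con (+ 2)) :^ 2) refl) (trans (cong (_^ₚ 2) eq) 0²≡0))
    a≢0 : a ≢ ⟦ 0 ⟧
    a≢0 = *ₚ-nonzero ⟦ 4 ⟧ (-ₚ ⟦ 2 ⟧ *ₚ C) 4≢0 (*ₚ-nonzero (-ₚ ⟦ 2 ⟧) C -2≢0 C≢0)
    κ≢0 : κ C D ⟦ 2 ⟧ ≢ ⟦ 0 ⟧
    κ≢0 eq = ^ₚ2-nonzero C C≢0 (trans (sym κ[2]) eq)

  fibre[2] : fibre ⟦ 2 ⟧ ≡ + p * (σ E * 𝟙 (κ C D ⟦ 2 ⟧ ≟ ⟦ 0 ⟧))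
  fibre[2] = [ fibre[2]-C≡0 , fibre[2]-C≢0 ]′ (toSum (C ≟ ⟦ 0 ⟧))

  -- The value of σ(x² - 4) at the roots of the cubic.

  m : 𝔽 p → 𝔽 p
  m x = ⟦ 2 ⟧ *ₚ x +ₚ (C -ₚ ⟦ 4 ⟧)

  -- As a function of D, κ(x) is affine with slope -(x - 2), and at D = `D•` it equals (x + 2) m(x)²
  -- / 4. Thus `m` is the factor that becomes a double root in the singular case.
  κ-square : ∀ x → ⟦ 4 ⟧ *ₚ κ C D x ≡ (x +ₚ ⟦ 2 ⟧) *ₚ m x ^ₚ 2 -ₚ (x -ₚ ⟦ 2 ⟧) *ₚ (⟦ 4 ⟧ *ₚ E)
  κ-square x = trans (solve 3 (λ C D x →
      con (+ 4) :* κᴾ C D x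
      := (x :+ con (+ 2)) :* (con (+ 2) :* x :+ (C :- con (+ 4))) :^ 2
         :- (x :- con (+ 2)) :* 4Eᴾ C D) refl C D x)
    (cong (λ t → (x +ₚ ⟦ 2 ⟧) *ₚ m x ^ₚ 2 -ₚ (x -ₚ ⟦ 2 ⟧) *ₚ t) (sym 4E))

  -- The factor x - 2 completes x + 2 to x² - 4 and at the same time makes the coefficient of E a
  -- square.
  κ-square-scaled : ∀ x → (x -ₚ ⟦ 2 ⟧) *ₚ (⟦ 4 ⟧ *ₚ κ C D x)
    ≡ m x ^ₚ 2 *ₚ (x ^ₚ 2 -ₚ ⟦ 4 ⟧) -ₚ (⟦ 2 ⟧ *ₚ (x -ₚ ⟦ 2 ⟧)) ^ₚ 2 *ₚ E
  κ-square-scaled x = trans (cong ((x -ₚ ⟦ 2 ⟧) *ₚ_) (κ-square x))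
    (solve 3 (λ x u e → (x :- con (+ 2)) :* ((x :+ con (+ 2)) :* u :^ 2 :- (x :- con (+ 2)) :* (con (+ 4) :* e))
      := u :^ 2 :* (x :^ 2 :- con (+ 4)) :- (con (+ 2) :* (x :- con (+ 2))) :^ 2 :* e) refl x (m x) E)

  -- At a root the scaled identity reads m² (x² - 4) = v² E, and nonzero square factors do not
  -- change `σ`.
  σ-at-root : E ≢ ⟦ 0 ⟧ → ∀ x → x ^ₚ 2 -ₚ ⟦ 4 ⟧ ≢ ⟦ 0 ⟧ → κ C D x ≡ ⟦ 0 ⟧ → σ (x ^ₚ 2 -ₚ ⟦ 4 ⟧) ≡ σ E
  σ-at-root E≢0 x x²-4≢0 κ≡0 = begin
    σ (x ^ₚ 2 -ₚ ⟦ 4 ⟧)                     ≡⟨ σ-u²a (m x) (x ^ₚ 2 -ₚ ⟦ 4 ⟧) m≢0 ⟨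
    σ (m x ^ₚ 2 *ₚ (x ^ₚ 2 -ₚ ⟦ 4 ⟧))       ≡⟨ cong σ m²[x²-4]≡v²E ⟩
    σ (v ^ₚ 2 *ₚ E)                         ≡⟨ σ-u²a v E v≢0 ⟩
    σ E                                     ∎
    where
    open ≡-Reasoning
    v : 𝔽 p
    v = ⟦ 2 ⟧ *ₚ (x -ₚ ⟦ 2 ⟧)
    v≢0 : v ≢ ⟦ 0 ⟧
    v≢0 = *ₚ-nonzero ⟦ 2 ⟧ (x -ₚ ⟦ 2 ⟧) 2≢0 (x-2≢0 x x²-4≢0)
    m²[x²-4]≡v²E : m x ^ₚ 2 *ₚ (x ^ₚ 2 -ₚ ⟦ 4 ⟧) ≡ v ^ₚ 2 *ₚ E
    m²[x²-4]≡v²E = a-b≡0⇒a≡b (m x ^ₚ 2 *ₚ (x ^ₚ 2 -ₚ ⟦ 4 ⟧)) (v ^ₚ 2 *ₚ E) (begin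
      m x ^ₚ 2 *ₚ (x ^ₚ 2 -ₚ ⟦ 4 ⟧) -ₚ v ^ₚ 2 *ₚ E    ≡⟨ κ-square-scaled x ⟨
      (x -ₚ ⟦ 2 ⟧) *ₚ (⟦ 4 ⟧ *ₚ κ C D x)              ≡⟨ cong (λ t → (x -ₚ ⟦ 2 ⟧) *ₚ (⟦ 4 ⟧ *ₚ t)) κ≡0 ⟩
      (x -ₚ ⟦ 2 ⟧) *ₚ (⟦ 4 ⟧ *ₚ ⟦ 0 ⟧)                ≡⟨ solve 1 (λ x → (x :- con (+ 2)) :* (con (+ 4) :* con 0ℤ) := con 0ℤ) refl x ⟩
      ⟦ 0 ⟧                                           ∎)
    -- This needs E ≠ 0: a zero of `m` would make v² E vanish, although v ≠ 0 away from x = 2.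
    m≢0 : m x ≢ ⟦ 0 ⟧
    m≢0 m≡0 = *ₚ-nonzero (v ^ₚ 2) E (^ₚ2-nonzero v v≢0) E≢0 (begin
      v ^ₚ 2 *ₚ E                           ≡⟨ m²[x²-4]≡v²E ⟨
      m x ^ₚ 2 *ₚ (x ^ₚ 2 -ₚ ⟦ 4 ⟧)         ≡⟨ cong (λ t → t ^ₚ 2 *ₚ (x ^ₚ 2 -ₚ ⟦ 4 ⟧)) m≡0 ⟩
      ⟦ 0 ⟧ ^ₚ 2 *ₚ (x ^ₚ 2 -ₚ ⟦ 4 ⟧)       ≡⟨ solve 1 (λ a → con 0ℤ :^ 2 :* a := con 0ℤ) refl (x ^ₚ 2 -ₚ ⟦ 4 ⟧) ⟩
      ⟦ 0 ⟧                                 ∎)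

  -- The case D ≠ `D•`.

  fibre-smooth : E ≢ ⟦ 0 ⟧ → ∀ x → x ≡ ⟦ 2 ⟧ ⊎ x ≡ -ₚ ⟦ 2 ⟧ ⊎ x ^ₚ 2 -ₚ ⟦ 4 ⟧ ≢ ⟦ 0 ⟧ →
    fibre x ≡ + p * (σ E * (𝟙 (x ≟ -ₚ ⟦ 2 ⟧) + 𝟙 (κ C D x ≟ ⟦ 0 ⟧))) - σ (x ^ₚ 2 -ₚ ⟦ 4 ⟧)
  fibre-smooth E≢0 _ (inj₁ refl) = begin
    fibre ⟦ 2 ⟧                                                   ≡⟨ fibre[2] ⟩
    + p * (σ E * k)                                               ≡⟨ rearrange (+ p) (σ E) k ⟩
    + p * (σ E * (0ℤ + k)) - 0ℤ                                   ≡⟨ cong₂ (λ s t → + p * (σ E * (s + k)) - t) (𝟙-no (⟦ 2 ⟧ ≟ -ₚ ⟦ 2 ⟧) 2≢-2) (σ-zero ([±2]²-4≡0 (inj₁ refl))) ⟨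
    + p * (σ E * (𝟙 (⟦ 2 ⟧ ≟ -ₚ ⟦ 2 ⟧) + k)) - σ (⟦ 2 ⟧ ^ₚ 2 -ₚ ⟦ 4 ⟧)   ∎
    where
    open ≡-Reasoning
    k : ℤ
    k = 𝟙 (κ C D ⟦ 2 ⟧ ≟ ⟦ 0 ⟧)
    rearrange : ∀ a b c → a * (b * c) ≡ a * (b * (0ℤ + c)) - 0ℤ
    rearrange = solve-∀
  fibre-smooth E≢0 x (inj₂ (inj₁ refl)) = begin
    fibre x                                                       ≡⟨ fibre[-2] ⟩
    + p * σ E                                                     ≡⟨ rearrange (+ p) (σ E) ⟩
    + p * (σ E * (1ℤ + 0ℤ)) - 0ℤ                                  ≡⟨ cong₂ (λ s t → + p * (σ E * (1ℤ + s)) - t) (𝟙-no (κ C D x ≟ ⟦ 0 ⟧) κ≢0) (σ-zero ([±2]²-4≡0 (inj₂ refl))) ⟨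
    + p * (σ E * (1ℤ + k)) - σ (x ^ₚ 2 -ₚ ⟦ 4 ⟧)                  ≡⟨ cong (λ s → + p * (σ E * (s + k)) - σ (x ^ₚ 2 -ₚ ⟦ 4 ⟧)) (𝟙-yes (x ≟ x) refl) ⟨
    + p * (σ E * (𝟙 (x ≟ x) + k)) - σ (x ^ₚ 2 -ₚ ⟦ 4 ⟧)           ∎
    where
    open ≡-Reasoning
    k : ℤ
    k = 𝟙 (κ C D x ≟ ⟦ 0 ⟧)
    κ≢0 : κ C D x ≢ ⟦ 0 ⟧
    κ≢0 eq = *ₚ-nonzero ⟦ 4 ⟧ E 4≢0 E≢0 (trans (sym κ[-2]) eq)
    rearrange : ∀ a b → a * b ≡ a * (b * (1ℤ + 0ℤ)) - 0ℤ
    rearrange = solve-∀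
  fibre-smooth E≢0 x (inj₂ (inj₂ x²-4≢0)) = begin
    fibre x                                        ≡⟨ fibre-generic x x²-4≢0 ⟩
    s * (+ p * 𝟙 (κ C D x ≟ ⟦ 0 ⟧) - 1ℤ)           ≡⟨ root-case (κ C D x ≟ ⟦ 0 ⟧) ⟩
    + p * (σ E * (0ℤ + 𝟙 (κ C D x ≟ ⟦ 0 ⟧))) - s   ≡⟨ cong (λ t → + p * (σ E * (t + 𝟙 (κ C D x ≟ ⟦ 0 ⟧))) - s) (𝟙-no (x ≟ -ₚ ⟦ 2 ⟧) (x²-4≢0 ∘ [±2]²-4≡0 ∘ inj₂)) ⟨
    + p * (σ E * (𝟙 (x ≟ -ₚ ⟦ 2 ⟧) + 𝟙 (κ C D x ≟ ⟦ 0 ⟧))) - s   ∎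
    where
    open ≡-Reasoning
    s : ℤ
    s = σ (x ^ₚ 2 -ₚ ⟦ 4 ⟧)
    root : ∀ a b → a * (b * 1ℤ - 1ℤ) ≡ b * (a * (0ℤ + 1ℤ)) - a
    root = solve-∀
    no-root : ∀ a b c → a * (b * 0ℤ - 1ℤ) ≡ b * (c * (0ℤ + 0ℤ)) - a
    no-root = solve-∀
    root-case : (κ≟0 : Dec (κ C D x ≡ ⟦ 0 ⟧)) → s * (+ p * 𝟙 κ≟0 - 1ℤ) ≡ + p * (σ E * (0ℤ + 𝟙 κ≟0)) - s
    root-case (yes κ≡0) = trans (root s (+ p)) (cong (λ t → + p * (t * (0ℤ + 1ℤ)) - s) (σ-at-root E≢0 x x²-4≢0 κ≡0))
    root-case (no _)    = no-root s (+ p) (σ E)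

  N₀³-smooth : E ≢ ⟦ 0 ⟧ → + N₀³ (f C D) ≡ + (p ℕ.^ 2) + 1ℤ + σ E * (1ℤ + + N₀¹ (κ C D)) * + p
  N₀³-smooth E≢0 = trans (N₀³-from-fibres T (λ x → fibre-smooth E≢0 x (trichotomy x))) (cong (λ s → + (p ℕ.^ 2) + 1ℤ + s * + p) sum-T)
    where
    open ≡-Reasoning
    T : 𝔽 p → ℤ
    T x = σ E * (𝟙 (x ≟ -ₚ ⟦ 2 ⟧) + 𝟙 (κ C D x ≟ ⟦ 0 ⟧))
    sum-T : sum T ≡ σ E * (1ℤ + + N₀¹ (κ C D))
    sum-T = begin
      sum T
        ≡⟨ *-distribˡ-sum (σ E) (λ x → 𝟙 (x ≟ -ₚ ⟦ 2 ⟧) + 𝟙 (κ C D x ≟ ⟦ 0 ⟧)) ⟨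
      σ E * ∑[ x < p ] (𝟙 (x ≟ -ₚ ⟦ 2 ⟧) + 𝟙 (κ C D x ≟ ⟦ 0 ⟧))
        ≡⟨ cong (_*_ (σ E)) (∑-distrib-+ (λ x → 𝟙 (x ≟ -ₚ ⟦ 2 ⟧)) (λ x → 𝟙 (κ C D x ≟ ⟦ 0 ⟧))) ⟩
      σ E * (∑[ x < p ] 𝟙 (x ≟ -ₚ ⟦ 2 ⟧) + ∑[ x < p ] 𝟙 (κ C D x ≟ ⟦ 0 ⟧))
        ≡⟨ cong (_*_ (σ E)) (cong₂ _+_ (sum-𝟙≟ (-ₚ ⟦ 2 ⟧)) (sym (length-filter-tabulate (λ x → κ C D x ≟ ⟦ 0 ⟧) id))) ⟩
      σ E * (1ℤ + + N₀¹ (κ C D)) ∎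

  -- The case D = `D•`.

  κ≡0⇔m≡0 : E ≡ ⟦ 0 ⟧ → ∀ x → x ^ₚ 2 -ₚ ⟦ 4 ⟧ ≢ ⟦ 0 ⟧ → (κ C D x ≡ ⟦ 0 ⟧) ⇔ (m x ≡ ⟦ 0 ⟧)
  κ≡0⇔m≡0 E≡0 x x²-4≢0 = mk⇔
    (λ κ≡0 → a²≡0⇒a≡0 (m x) (ab≡0⇒b≡0 (x +ₚ ⟦ 2 ⟧) (m x ^ₚ 2) (x+2≢0 x x²-4≢0)
      (trans (sym 4κ≡) (trans (cong (⟦ 4 ⟧ *ₚ_) κ≡0) (*ₚ-zeroʳ ⟦ 4 ⟧)))))
    (λ m≡0 → ab≡0⇒b≡0 ⟦ 4 ⟧ (κ C D x) 4≢0
      (trans 4κ≡ (trans (cong (λ t → (x +ₚ ⟦ 2 ⟧) *ₚ t ^ₚ 2) m≡0)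
        (solve 1 (λ x → (x :+ con (+ 2)) :* con 0ℤ :^ 2 := con 0ℤ) refl x))))
    where
    4κ≡ : ⟦ 4 ⟧ *ₚ κ C D x ≡ (x +ₚ ⟦ 2 ⟧) *ₚ m x ^ₚ 2
    4κ≡ = trans (κ-square x) (trans
      (cong (λ t → (x +ₚ ⟦ 2 ⟧) *ₚ m x ^ₚ 2 -ₚ (x -ₚ ⟦ 2 ⟧) *ₚ (⟦ 4 ⟧ *ₚ t)) E≡0)
      (solve 2 (λ x u → (x :+ con (+ 2)) :* u :^ 2 :- (x :- con (+ 2)) :* (con (+ 4) :* con 0ℤ)
        := (x :+ con (+ 2)) :* u :^ 2) refl x (m x)))

  -- From 2x = 4 - C one gets 4 (x² - 4) = (C - 4)² - 16 = C² - 8C.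
  m≡0⇒σ[x²-4] : ∀ x → m x ≡ ⟦ 0 ⟧ → σ (x ^ₚ 2 -ₚ ⟦ 4 ⟧) ≡ σ (C ^ₚ 2 -ₚ ⟦ 8 ⟧ *ₚ C)
  m≡0⇒σ[x²-4] x m≡0 = begin
    σ (x ^ₚ 2 -ₚ ⟦ 4 ⟧)                   ≡⟨ σ-u²a ⟦ 2 ⟧ (x ^ₚ 2 -ₚ ⟦ 4 ⟧) 2≢0 ⟨
    σ (⟦ 2 ⟧ ^ₚ 2 *ₚ (x ^ₚ 2 -ₚ ⟦ 4 ⟧))   ≡⟨ cong σ (begin
      ⟦ 2 ⟧ ^ₚ 2 *ₚ (x ^ₚ 2 -ₚ ⟦ 4 ⟧)
        ≡⟨ solve 2 (λ C x → con (+ 2) :^ 2 :* (x :^ 2 :- con (+ 4))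
             := (con (+ 2) :* x :+ (C :- con (+ 4))) :* (con (+ 2) :* x :- (C :- con (+ 4)))
                :+ (C :^ 2 :- con (+ 8) :* C)) refl C x ⟩
      m x *ₚ (⟦ 2 ⟧ *ₚ x -ₚ (C -ₚ ⟦ 4 ⟧)) +ₚ (C ^ₚ 2 -ₚ ⟦ 8 ⟧ *ₚ C)
        ≡⟨ cong (λ t → t *ₚ (⟦ 2 ⟧ *ₚ x -ₚ (C -ₚ ⟦ 4 ⟧)) +ₚ (C ^ₚ 2 -ₚ ⟦ 8 ⟧ *ₚ C)) m≡0 ⟩
      ⟦ 0 ⟧ *ₚ (⟦ 2 ⟧ *ₚ x -ₚ (C -ₚ ⟦ 4 ⟧)) +ₚ (C ^ₚ 2 -ₚ ⟦ 8 ⟧ *ₚ C)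
        ≡⟨ solve 2 (λ u v → con 0ℤ :* u :+ v := v) refl (⟦ 2 ⟧ *ₚ x -ₚ (C -ₚ ⟦ 4 ⟧)) (C ^ₚ 2 -ₚ ⟦ 8 ⟧ *ₚ C) ⟩
      C ^ₚ 2 -ₚ ⟦ 8 ⟧ *ₚ C ∎) ⟩
    σ (C ^ₚ 2 -ₚ ⟦ 8 ⟧ *ₚ C)              ∎
    where open ≡-Reasoning

  -- Replaces a coefficient that varies with `x` by a constant, which can then be taken out of the
  -- sum over `x`.
  σ[x²-4]*𝟙[m≡0] : ∀ x (m≟0 : Dec (m x ≡ ⟦ 0 ⟧)) → σ (x ^ₚ 2 -ₚ ⟦ 4 ⟧) * 𝟙 m≟0 ≡ σ (C ^ₚ 2 -ₚ ⟦ 8 ⟧ *ₚ C) * 𝟙 m≟0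
  σ[x²-4]*𝟙[m≡0] x (yes m≡0) = cong (_* 1ℤ) (m≡0⇒σ[x²-4] x m≡0)
  σ[x²-4]*𝟙[m≡0] x (no _)    =
    trans (ℤ.*-zeroʳ (σ (x ^ₚ 2 -ₚ ⟦ 4 ⟧))) (sym (ℤ.*-zeroʳ (σ (C ^ₚ 2 -ₚ ⟦ 8 ⟧ *ₚ C))))

  -- The root of `m` may itself be 2 or -2, namely for C = 0 or C = 8, but then C² - 8C = 0. The
  -- proof sees this through σ(x² - 4) = 0, so the term in p vanishes in either event.
  fibre≡0-singular : ∀ x → x ≡ ⟦ 2 ⟧ ⊎ x ≡ -ₚ ⟦ 2 ⟧ → fibre x ≡ 0ℤ →
    fibre x ≡ + p * (σ (C ^ₚ 2 -ₚ ⟦ 8 ⟧ *ₚ C) * 𝟙 (m x ≟ ⟦ 0 ⟧)) - σ (x ^ₚ 2 -ₚ ⟦ 4 ⟧)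
  fibre≡0-singular x x≡±2 fibre≡0 = begin
    fibre x                          ≡⟨ fibre≡0 ⟩
    0ℤ                               ≡⟨ rearrange (+ p) k ⟩
    + p * (0ℤ * k) - 0ℤ              ≡⟨ cong (λ s → + p * (s * k) - s) (σ-zero ([±2]²-4≡0 x≡±2)) ⟨
    + p * (s * k) - s                ≡⟨ cong (λ t → + p * t - s) (σ[x²-4]*𝟙[m≡0] x (m x ≟ ⟦ 0 ⟧)) ⟩
    + p * (σ (C ^ₚ 2 -ₚ ⟦ 8 ⟧ *ₚ C) * k) - s  ∎
    where
    open ≡-Reasoning
    s k : ℤ
    s = σ (x ^ₚ 2 -ₚ ⟦ 4 ⟧)
    k = 𝟙 (m x ≟ ⟦ 0 ⟧)
    rearrange : ∀ a b → 0ℤ ≡ a * (0ℤ * b) - 0ℤ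
    rearrange = solve-∀

  fibre-singular : E ≡ ⟦ 0 ⟧ → ∀ x → x ≡ ⟦ 2 ⟧ ⊎ x ≡ -ₚ ⟦ 2 ⟧ ⊎ x ^ₚ 2 -ₚ ⟦ 4 ⟧ ≢ ⟦ 0 ⟧ →
    fibre x ≡ + p * (σ (C ^ₚ 2 -ₚ ⟦ 8 ⟧ *ₚ C) * 𝟙 (m x ≟ ⟦ 0 ⟧)) - σ (x ^ₚ 2 -ₚ ⟦ 4 ⟧)
  fibre-singular E≡0 x (inj₁ refl) = fibre≡0-singular x (inj₁ refl) (begin
    fibre x                                         ≡⟨ fibre[2] ⟩
    + p * (σ E * 𝟙 (κ C D x ≟ ⟦ 0 ⟧))               ≡⟨ cong (λ s → + p * (s * 𝟙 (κ C D x ≟ ⟦ 0 ⟧))) (σ-zero E≡0) ⟩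
    + p * (0ℤ * 𝟙 (κ C D x ≟ ⟦ 0 ⟧))                ≡⟨ cong (_*_ (+ p)) (ℤ.*-zeroˡ (𝟙 (κ C D x ≟ ⟦ 0 ⟧))) ⟩
    + p * 0ℤ                                        ≡⟨ ℤ.*-zeroʳ (+ p) ⟩
    0ℤ                                              ∎)
    where open ≡-Reasoning
  fibre-singular E≡0 x (inj₂ (inj₁ refl)) = fibre≡0-singular x (inj₂ refl)
    (trans fibre[-2] (trans (cong (_*_ (+ p)) (σ-zero E≡0)) (ℤ.*-zeroʳ (+ p))))
  fibre-singular E≡0 x (inj₂ (inj₂ x²-4≢0)) = begin
    fibre x                                        ≡⟨ fibre-generic x x²-4≢0 ⟩
    s * (+ p * 𝟙 (κ C D x ≟ ⟦ 0 ⟧) - 1ℤ)           ≡⟨ cong (λ k → s * (+ p * k - 1ℤ)) (𝟙-⇔ (κ≡0⇔m≡0 E≡0 x x²-4≢0) (κ C D x ≟ ⟦ 0 ⟧) (m x ≟ ⟦ 0 ⟧)) ⟩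
    s * (+ p * 𝟙 (m x ≟ ⟦ 0 ⟧) - 1ℤ)               ≡⟨ rearrange s (+ p) (𝟙 (m x ≟ ⟦ 0 ⟧)) ⟩
    + p * (s * 𝟙 (m x ≟ ⟦ 0 ⟧)) - s                ≡⟨ cong (λ t → + p * t - s) (σ[x²-4]*𝟙[m≡0] x (m x ≟ ⟦ 0 ⟧)) ⟩
    + p * (σ (C ^ₚ 2 -ₚ ⟦ 8 ⟧ *ₚ C) * 𝟙 (m x ≟ ⟦ 0 ⟧)) - s   ∎
    where
    open ≡-Reasoning
    s : ℤ
    s = σ (x ^ₚ 2 -ₚ ⟦ 4 ⟧)
    rearrange : ∀ a b c → a * (b * c - 1ℤ) ≡ b * (a * c) - a
    rearrange = solve-∀

  N₀³-singular : E ≡ ⟦ 0 ⟧ → + N₀³ (f C D) ≡ + (p ℕ.^ 2) + 1ℤ + σ (C ^ₚ 2 -ₚ ⟦ 8 ⟧ *ₚ C) * + p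
  N₀³-singular E≡0 = trans (N₀³-from-fibres T (λ x → fibre-singular E≡0 x (trichotomy x))) (cong (λ s → + (p ℕ.^ 2) + 1ℤ + s * + p) sum-T)
    where
    open ≡-Reasoning
    s : ℤ
    s = σ (C ^ₚ 2 -ₚ ⟦ 8 ⟧ *ₚ C)
    T : 𝔽 p → ℤ
    T x = s * 𝟙 (m x ≟ ⟦ 0 ⟧)
    sum-T : sum T ≡ s
    sum-T = begin
      sum T                                 ≡⟨ *-distribˡ-sum s (λ x → 𝟙 (m x ≟ ⟦ 0 ⟧)) ⟨
      -- `m` is affine of slope 2 ≠ 0, so exactly one x carries the whole coefficient of p.
      s * ∑[ x < p ] 𝟙 (m x ≟ ⟦ 0 ⟧)        ≡⟨ cong (_*_ s) (sum-𝟙-affine ⟦ 2 ⟧ (C -ₚ ⟦ 4 ⟧) 2≢0) ⟩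
      s * 1ℤ                                ≡⟨ ℤ.*-identityʳ s ⟩
      s                                     ∎

theorem6p1 : (p : ℕ) .{{_ : NonZero p}} → Prime p → 5 ℕ.≤ p → (C D : 𝔽 p) →
    (D ≡ D• C → + N₀³ (f C D) ≡ + (p ℕ.^ 2) + 1ℤ + σ (C ^ₚ 2 -ₚ ⟦ 8 ⟧ *ₚ C) * + p)
    ×
    (D ≢ D• C → + N₀³ (f C D) ≡ + (p ℕ.^ 2) + 1ℤ + σ (D -ₚ D• C) * (1ℤ + + N₀¹ (κ C D)) * + p)
theorem6p1 p p-prime 5≤p C D =
    (λ D≡D• → N₀³-singular (trans (cong (_-ₚ D• C) D≡D•) (+ₚ-inverseʳ (D• C))))
  , (λ D≢D• → N₀³-smooth (D≢D• ∘ a-b≡0⇒a≡b D (D• C)))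
  where
  2≢0 : ⟦_⟧ {p} 2 ≢ ⟦ 0 ⟧
  2≢0 eq = contradiction (begin
    2                  ≡⟨ m<n⇒m%n≡m (ℕ.≤-trans (ℕ.m≤m+n 3 2) 5≤p) ⟨
    2 % p              ≡⟨ toℕ-fromℕ< (m%n<n 2 p) ⟨
    toℕ (⟦_⟧ {p} 2)    ≡⟨ cong toℕ eq ⟩
    toℕ (⟦_⟧ {p} 0)    ≡⟨ toℕ-fromℕ< (m%n<n 0 p) ⟩
    0 % p              ≡⟨ m<n⇒m%n≡m (ℕ.≤-trans (ℕ.m≤m+n 1 4) 5≤p) ⟩
    0                  ∎) λ ()
    where open ≡-Reasoning
  open OddPrimeField p-prime 2≢0 using (+ₚ-inverseʳ; a-b≡0⇒a≡b)
  open CubicSurface p-prime 2≢0 C D
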